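{- Let $p>3$ be a prime and $t\in\mathbb Z_p$. Then $$P_{\frac{p-1}2}(t)\equiv\sum_{k=0}^{\frac{p-1}2}\binom{2k}k^2\Big(\frac{1-t}{32}\Big)^k\equiv-\Big(\frac{ -6}p\Big)\sum_{x=0}^{p-1}\Big(\frac{x^3-3(t^2+3)x+2t(t^2-9)}p\Big)\pmod p.$$
   Context: $\mathbb Z_p$ denotes the set of rational numbers whose denominator (in lowest terms) is prime to $p$; congruences are in this ring. For $a\in\mathbb Z_p$, $\big(\frac ap\big)$ is the Legendre symbol of the residue of $a$ modulo $p$ (equal to $0$ if $p\mid a$). $P_n(x)$ is the $n$-th Legendre polynomial, defined by $\frac1{\sqrt{1-2xt+t^2}}=\sum_{n\ge0}P_n(x)t^n$, equivalently $P_n(x)=\frac1{2^n}\sum_{k=0}^{[n/2]}\frac{(-1)^k(2n-2k)!}{k!(n-k)!(n-2k)!}x^{n-2k}$. -}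

module Defs where

open import Algebra.Bundles using (CommutativeRing)
import Algebra.Properties.CommutativeMonoid.Sum as Sum
import Algebra.Properties.Semiring.Exp as Exp
open import Data.Fin.Base using (Fin; toℕ)
open import Data.Fin.Properties using (any?)
open import Data.Integer.Base as ℤ using (ℤ; +_; 0ℤ; 1ℤ; -1ℤ)
open import Data.Integer.Divisibility.Signed using (_∣_; _∣?_)
open import Data.Nat.Base as ℕ using (ℕ; _∸_; _!)
open import Data.Nat.Coprimality using (Coprime)
open import Data.Nat.Properties using (m*n≢0; m^n≢0; _!≢0)
open import Data.Product.Base using (∃; _,_)
open import Data.Rational.Base using (ℚ; _+_; _-_; _*_; _/_; ↥_; ↧_; ↧ₙ_)
open import Data.Rational.Properties using (+-*-commutativeRing; +-0-commutativeMonoid)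
open import Relation.Binary.PropositionalEquality.Core using (_≡_)
open import Relation.Nullary.Decidable.Core using (Dec; yes; no)

open Sum +-0-commutativeMonoid public using (sum⁺-syntax; sum-syntax)
open Exp (CommutativeRing.semiring +-*-commutativeRing) public using (_^_)

ℤ→ℚ : ℤ → ℚ
ℤ→ℚ m = m / 1

ℕ→ℚ : ℕ → ℚ
ℕ→ℚ m = ℤ→ℚ (+ m)

-- The ring ℤ_p of p-integral rationals. Elements of ℚ are stored in lowest
-- terms, so ↧ₙ a is the reduced denominator.

infix 4 _∈ℤ₍_₎

record _∈ℤ₍_₎ (a : ℚ) (p : ℕ) : Set where
  constructor p-integral
  field
    denominator-coprime : Coprime (↧ₙ a) p

-- Congruence in ℤ_p modulo its ideal (p). That both sides lie in ℤ_p is part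
-- of the relation.

infix 4 _≡_[mod_]

record _≡_[mod_] (a b : ℚ) (p : ℕ) : Set where
  constructor congruent
  field
    left-integral     : a ∈ℤ₍ p ₎
    right-integral    : b ∈ℤ₍ p ₎
    quotient          : ℚ
    quotient-integral : quotient ∈ℤ₍ p ₎
    difference        : a - b ≡ ℕ→ℚ p * quotient

-- The residue modulo p of n/d ∈ ℤ_p is the r ∈ {0,…,p-1} with r d ≡ n (mod p).
-- For p prime and a ∈ ℤ_p it exists and is unique. The value 0 in the other
-- case is a convention for rationals outside ℤ_p.

IsResidue : (p : ℕ) → ℚ → Fin p → Set
IsResidue p a r = + p ∣ + toℕ r ℤ.* ↧ a ℤ.- ↥ a

residue : ℕ → ℚ → ℤ
residue p a with any? {P = IsResidue p a} (λ r → + p ∣? + toℕ r ℤ.* ↧ a ℤ.- ↥ a)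
... | yes (r , _) = + toℕ r
... | no  _       = 0ℤ

IsSquareMod : ℕ → ℤ → Set
IsSquareMod p m = ∃ λ (y : Fin p) → + p ∣ (+ toℕ y) ℤ.^ 2 ℤ.- m

isSquareMod? : ∀ p m → Dec (IsSquareMod p m)
isSquareMod? p m = any? (λ y → + p ∣? (+ toℕ y) ℤ.^ 2 ℤ.- m)

legendreℤ : ℤ → ℕ → ℤ
legendreℤ m p with + p ∣? m | isSquareMod? p m
... | yes _ | _     = 0ℤ
... | no  _ | yes _ = 1ℤ
... | no  _ | no  _ = -1ℤ

legendre : ℚ → ℕ → ℤ
legendre a p = legendreℤ (residue p a) p

-- The coefficient (-1)ᵏ (2n-2k)! / (k! (n-k)! (n-2k)!), for 2k ≤ n.

legendreCoeff : ℕ → ℕ → ℚ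
legendreCoeff n k =
  (-1ℤ ℤ.^ k ℤ.* + ((2 ℕ.* n ∸ 2 ℕ.* k) !))
    / (k ! ℕ.* (n ∸ k) ! ℕ.* (n ∸ 2 ℕ.* k) !)
  where
  instance
    _ = k !≢0
    _ = (n ∸ k) !≢0
    _ = (n ∸ 2 ℕ.* k) !≢0
    _ = m*n≢0 (k !) ((n ∸ k) !)
    _ = m*n≢0 (k ! ℕ.* (n ∸ k) !) ((n ∸ 2 ℕ.* k) !)

-- The Legendre polynomial Pₙ as a function on ℚ.

legendreP : ℕ → ℚ → ℚ
legendreP n x =
  (+ 1 / 2 ℕ.^ n) * (∑[ k ≤ n ℕ./ 2 ] (legendreCoeff n (toℕ k) * x ^ (n ∸ 2 ℕ.* toℕ k)))
  where
  instance
    _ = m^n≢0 2 n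

{-# OPTIONS --safe #-}

-- Write p = 2n + 1 and f(x) = x³ - 3(t² + 3)x + 2t(t² - 9) = (x + 2t)((x - t)² - 9). By Euler's
-- criterion the character sum is ≡ ∑ₓ f(x)ⁿ. A power sum ∑ₓ xᵐ with m < 4n vanishes mod p unless
-- m = 2n, when it is -1; so the sum over x picks out a single coefficient of a polynomial in x.
-- * Translating x by t gives f(x + t) = (x + 3t)(x² - 9), whence
--     ∑ₓ f(x)ⁿ ≡ -3ⁿ ∑ₖ (-1)ᵏ C(n,k) C(n,2k) tⁿ⁻²ᵏ ≡ -(-6)ⁿ Pₙ(t),
--   because C(2n-2k,n) ≡ (-1)ⁿ C(n,2k).
-- * Translating x by t - 3 gives f(x + t - 3) = x(x - 6)(x + 3(t - 1)), whence
--     ∑ₓ f(x)ⁿ ≡ -(-6)ⁿ ∑ₖ C(n,k)² ((1 - t)/2)ᵏ,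
--   which is the binomial sum, because C(2k,k) ≡ (-4)ᵏ C(n,k).
-- Euler's criterion for a nonsquare a follows from the same power sums: expanding the binomial,
-- ∑ᵧ (y² - a)²ⁿ ≡ -aⁿ - 1, while each of the p summands is 1.

module Submission where

open import Data.Nat.Base as ℕ using (ℕ; zero; suc; _<_; _≤_; _∸_; s≤s; z≤n; s<s; z<s; NonZero; _!)
open import Data.Nat.Combinatorics
  using (_C_; nCk≡nC[n∸k]; nCn≡1; nC1≡n; k>n⇒nCk≡0; nCk+nC[k+1]≡[n+1]C[k+1]; nCk≡n!/k![n-k]!; k![n∸k]!∣n!)
import Data.Nat.Properties as ℕP
open import Data.Nat.Solver using () renaming (module +-*-Solver to ℕS)
open import Relation.Binary.PropositionalEquality as ≡ using (_≡_; _≢_)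

-- The roots of f are -2t and t ± 3. Centring the pair t ± 3 at 0 leaves an even quadratic factor,
-- which is why only the even-indexed coefficients typical of a Legendre polynomial appear. Moving t
-- - 3 to 0 instead leaves a bare factor x, and the two remaining n-th powers contribute C(n,k) and
-- C(n,n-k), hence squares. As fⁿ has degree 3n < 4n, a single power sum survives in both cases.
-- Since (-6)ⁿ squares to 1, it can change sides, so both sums of the theorem are brought to the
-- common value -(-6)ⁿ ∑ₓ f(x)ⁿ.
--
-- Congruence modulo p is made the equality of a commutative ring with carrier ℤ_p, and the number
-- theory is done in any commutative ring where p = 0 and every element is an integer multiple of 1.
-- There the only division is cancellation of an integer prime to p. Power sums are found from
-- invariance under translation rather than from a primitive root, and Euler's criterion is proved
-- without counting roots of polynomials.

module NatBinomials where
  open ≡ using (refl; cong; cong₂; trans)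
  open import Data.Nat.Base using (_+_; _*_)
  open ≡.≡-Reasoning

  -- Recurrences for binomial coefficients over ℕ.

  C-zero : ∀ n → n C 0 ≡ 1
  C-zero n = trans (nCk≡nC[n∸k] {0} {n} z≤n) (nCn≡1 n)

  C-absorb : ∀ n k → suc k * (suc n C suc k) ≡ suc n * (n C k)
  C-absorb zero zero = refl
  C-absorb zero (suc k) = begin
    suc (suc k) * (1 C suc (suc k))  ≡⟨ cong (suc (suc k) *_) (k>n⇒nCk≡0 {1} {suc (suc k)} (s<s z<s)) ⟩
    suc (suc k) * 0                  ≡⟨ ℕP.*-zeroʳ (suc (suc k)) ⟩
    0                                ≡⟨ cong (1 *_) (k>n⇒nCk≡0 {0} {suc k} z<s) ⟨
    1 * (0 C suc k)                  ∎
  C-absorb (suc m) zero = begin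
    1 * (suc (suc m) C 1)          ≡⟨ ℕP.*-identityˡ _ ⟩
    suc (suc m) C 1                ≡⟨ nC1≡n (suc (suc m)) ⟩
    suc (suc m)                    ≡⟨ ℕP.*-identityʳ _ ⟨
    suc (suc m) * 1                ≡⟨ cong (suc (suc m) *_) (C-zero (suc m)) ⟨
    suc (suc m) * (suc m C 0)      ∎
  C-absorb (suc m) (suc k) = begin
    suc (suc k) * (suc (suc m) C suc (suc k))
      ≡⟨ cong (suc (suc k) *_) (nCk+nC[k+1]≡[n+1]C[k+1] (suc m) (suc k)) ⟨
    suc (suc k) * (X + (suc m C suc (suc k)))
      ≡⟨ ℕP.*-distribˡ-+ (suc (suc k)) X _ ⟩
    (X + suc k * X) + suc (suc k) * (suc m C suc (suc k))
      ≡⟨ cong₂ _+_ (cong (X +_) (C-absorb m k)) (C-absorb m (suc k)) ⟩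
    (X + suc m * (m C k)) + suc m * (m C suc k)
      ≡⟨ ℕP.+-assoc X _ _ ⟩
    X + (suc m * (m C k) + suc m * (m C suc k))
      ≡⟨ cong (X +_) (ℕP.*-distribˡ-+ (suc m) (m C k) (m C suc k)) ⟨
    X + suc m * ((m C k) + (m C suc k))
      ≡⟨ cong (λ Y → X + suc m * Y) (nCk+nC[k+1]≡[n+1]C[k+1] m k) ⟩
    X + suc m * X ∎
    where X = suc m C suc k

  -- Moving k C(n,k) to the left avoids the truncated difference n ∸ k, so the recurrence survives
  -- for k > n. Adding C(n,k) to both sides turns the left into (k+1) times a Pascal sum, to which
  -- absorption applies.
  C-step : ∀ n k → suc k * (n C suc k) + k * (n C k) ≡ n * (n C k)
  C-step n k = ℕP.+-cancelˡ-≡ (n C k) _ _ (begin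
    (n C k) + (suc k * (n C suc k) + k * (n C k))
      ≡⟨ solve 3 (λ k x y → x :+ ((con 1 :+ k) :* y :+ k :* x) := (con 1 :+ k) :* (x :+ y)) refl k (n C k) (n C suc k) ⟩
    suc k * ((n C k) + (n C suc k))
      ≡⟨ cong (suc k *_) (nCk+nC[k+1]≡[n+1]C[k+1] n k) ⟩
    suc k * (suc n C suc k)
      ≡⟨ C-absorb n k ⟩
    suc n * (n C k) ∎)
    where open ℕS

  -- Absorption is applied twice. In between, the reflection C(2k+1,k) = C(2k+1,k+1) and 2k+2 =
  -- 2(k+1) provide the factor k+1 that the second application consumes.
  C-central : ∀ k → suc k * ((2 * suc k) C suc k) ≡ 2 * (suc (2 * k) * ((2 * k) C k))
  C-central k = begin
    suc k * ((2 * suc k) C suc k)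
      ≡⟨ cong (λ N → suc k * (N C suc k)) 2[1+k] ⟩
    suc k * (suc (suc (2 * k)) C suc k)
      ≡⟨ C-absorb (suc (2 * k)) k ⟩
    suc (suc (2 * k)) * (suc (2 * k) C k)
      ≡⟨ cong₂ _*_ 2[1+k] (trans (nCk≡nC[n∸k] (s≤s (ℕP.m≤m+n k _))) (cong (suc (2 * k) C_) [1+2k]∸[1+k])) ⟨
    (2 * suc k) * (suc (2 * k) C suc k)
      ≡⟨ ℕP.*-assoc 2 (suc k) _ ⟩
    2 * (suc k * (suc (2 * k) C suc k))
      ≡⟨ cong (2 *_) (C-absorb (2 * k) k) ⟩
    2 * (suc (2 * k) * ((2 * k) C k)) ∎
    where
    2[1+k] : 2 * suc k ≡ suc (suc (2 * k))
    2[1+k] = ℕP.*-suc 2 k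
    [1+2k]∸[1+k] : suc (2 * k) ∸ suc k ≡ k
    [1+2k]∸[1+k] = trans (ℕP.m+n∸m≡n k (k + 0)) (ℕP.+-identityʳ k)

open import Algebra.Bundles using (CommutativeRing)
import Algebra.Properties.CommutativeSemiring.Binomial as Binomial
open import Algebra.Solver.Ring.AlmostCommutativeRing as ACR using (_-Raw-AlmostCommutative⟶_)
open import Data.Fin.Base using (toℕ; fromℕ<)
open import Data.Fin.Properties using (any?; toℕ<n; toℕ-fromℕ<)
open import Data.Integer.Base as ℤ using (ℤ; +_; -[1+_]; -1ℤ)
open import Data.Integer.Divisibility.Signed as ℤ∣ using ()
import Data.Integer.Properties as ℤP
open import Data.Maybe.Base using (Maybe; just; nothing)
import Data.Nat.Coprimality as Coprime
open import Data.Nat.Divisibility as ℕ∣ using (divides)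
import Data.Nat.DivMod as ℕDM
open import Data.Nat.GCD using (module Bézout)
open import Data.Nat.Induction using (<-rec)
open import Data.Nat.Primality using (Prime; prime⇒irreducible; euclidsLemma)
open import Data.Product.Base using (∃; _×_; _,_; proj₁; proj₂)
open import Data.Sum.Base using (_⊎_; inj₁; inj₂)
open import Defs using (legendreℤ; isSquareMod?)
open import Function.Base using (_∘_)
open import Relation.Binary.Definitions using (tri<; tri≈; tri>)
open import Relation.Nullary.Decidable.Core using (yes; no)
open import Relation.Nullary.Negation using (contradiction; ¬_)

open NatBinomials

-- The image of ℤ in a commutative ring, and a ring solver with integer numerals.

module IntegerMultiples {c ℓ} (R : CommutativeRing c ℓ) where

  open CommutativeRing R
  open import Algebra.Properties.Ring ring
  open import Algebra.Properties.CommutativeSemigroup +-commutativeSemigroup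
    using (interchange)
  import Algebra.Properties.Semiring.Mult.TCOptimised semiring as Mult
  open import Algebra.Definitions.RawMonoid +-rawMonoid using (_×′_)
  open import Relation.Binary.Reasoning.Setoid setoid

  -- With this form of multiple, `ι 1` reduces to `1#`, so the numeral `con (+ 1)` of the solver
  -- agrees with `1#` in goals by `refl`.
  ι : ℕ → Carrier
  ι n = n ×′ 1#

  ι-suc : ∀ n → ι (suc n) ≈ 1# + ι n
  ι-suc n = Mult.1+× n 1#

  ι-+ : ∀ m n → ι (m ℕ.+ n) ≈ ι m + ι n
  ι-+ = Mult.×-homo-+ 1#

  ι-* : ∀ m n → ι (m ℕ.* n) ≈ ι m * ι n
  ι-* = Mult.×1-homo-*

  ⟦_⟧ : ℤ → Carrier
  ⟦ + n ⟧      = ι n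
  ⟦ -[1+ n ] ⟧ = - ι (suc n)

  ⟦⟧-⊖ : ∀ m n → ⟦ m ℤ.⊖ n ⟧ ≈ ι m - ι n
  ⟦⟧-⊖ m zero = begin
    ι m       ≈⟨ +-identityʳ _ ⟨
    ι m + 0#  ≈⟨ +-congˡ -0#≈0# ⟨
    ι m - 0#  ∎
  ⟦⟧-⊖ zero (suc n) = sym (+-identityˡ _)
  ⟦⟧-⊖ (suc m) (suc n) = begin
    ⟦ suc m ℤ.⊖ suc n ⟧            ≡⟨ ≡.cong ⟦_⟧ (ℤP.[1+m]⊖[1+n]≡m⊖n m n) ⟩
    ⟦ m ℤ.⊖ n ⟧                    ≈⟨ ⟦⟧-⊖ m n ⟩
    ι m - ι n                    ≈⟨ +-identityˡ _ ⟨
    0# + (ι m - ι n)             ≈⟨ +-congʳ (-‿inverseʳ 1#) ⟨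
    (1# - 1#) + (ι m - ι n)      ≈⟨ interchange 1# (- 1#) (ι m) (- ι n) ⟩
    (1# + ι m) + (- 1# - ι n)    ≈⟨ +-cong (sym (ι-suc m)) (-‿+-comm 1# (ι n)) ⟩
    ι (suc m) - (1# + ι n)       ≈⟨ +-congˡ (-‿cong (ι-suc n)) ⟨
    ι (suc m) - ι (suc n)        ∎

  ⟦⟧-neg : ∀ i → ⟦ ℤ.- i ⟧ ≈ - ⟦ i ⟧
  ⟦⟧-neg (+ zero)   = sym -0#≈0#
  ⟦⟧-neg (+ suc n)  = refl
  ⟦⟧-neg -[1+ n ]   = sym (-‿involutive _)

  ⟦⟧-+ : ∀ i j → ⟦ i ℤ.+ j ⟧ ≈ ⟦ i ⟧ + ⟦ j ⟧
  ⟦⟧-+ (+ m)    (+ n)    = ι-+ m n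
  ⟦⟧-+ (+ m)    -[1+ n ] = ⟦⟧-⊖ m (suc n)
  ⟦⟧-+ -[1+ m ] (+ n)    = trans (⟦⟧-⊖ n (suc m)) (+-comm _ _)
  ⟦⟧-+ -[1+ m ] -[1+ n ] = begin
    - ι (suc (suc (m ℕ.+ n)))    ≈⟨ -‿cong (begin
      ι (suc (suc (m ℕ.+ n)))    ≈⟨ ι-suc (suc (m ℕ.+ n)) ⟩
      1# + ι (suc m ℕ.+ n)       ≈⟨ +-congˡ (ι-+ (suc m) n) ⟩
      1# + (ι (suc m) + ι n)     ≈⟨ +-assoc _ _ _ ⟨
      (1# + ι (suc m)) + ι n     ≈⟨ +-congʳ (+-comm _ _) ⟩
      (ι (suc m) + 1#) + ι n     ≈⟨ +-assoc _ _ _ ⟩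
      ι (suc m) + (1# + ι n)     ≈⟨ +-congˡ (ι-suc n) ⟨
      ι (suc m) + ι (suc n)      ∎) ⟩
    - (ι (suc m) + ι (suc n))    ≈⟨ -‿+-comm _ _ ⟨
    - ι (suc m) - ι (suc n)      ∎

  ⟦⟧-*-+ : ∀ m j → ⟦ + m ℤ.* j ⟧ ≈ ι m * ⟦ j ⟧
  ⟦⟧-*-+ m (+ n) = begin
    ⟦ + m ℤ.* + n ⟧  ≡⟨ ≡.cong ⟦_⟧ (ℤP.pos-* m n) ⟨
    ι (m ℕ.* n)      ≈⟨ ι-* m n ⟩
    ι m * ι n        ∎
  ⟦⟧-*-+ m -[1+ n ] = begin
    ⟦ + m ℤ.* -[1+ n ] ⟧        ≡⟨ ≡.cong ⟦_⟧ (ℤP.neg-distribʳ-* (+ m) (+ suc n)) ⟨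
    ⟦ ℤ.- (+ m ℤ.* + suc n) ⟧   ≈⟨ ⟦⟧-neg (+ m ℤ.* + suc n) ⟩
    - ⟦ + m ℤ.* + suc n ⟧       ≡⟨ ≡.cong (λ i → - ⟦ i ⟧) (ℤP.pos-* m (suc n)) ⟨
    - ι (m ℕ.* suc n)           ≈⟨ -‿cong (ι-* m (suc n)) ⟩
    - (ι m * ι (suc n))         ≈⟨ -‿distribʳ-* _ _ ⟩
    ι m * - ι (suc n)           ∎

  ⟦⟧-* : ∀ i j → ⟦ i ℤ.* j ⟧ ≈ ⟦ i ⟧ * ⟦ j ⟧
  ⟦⟧-* (+ m)    j = ⟦⟧-*-+ m j
  ⟦⟧-* -[1+ m ] j = begin
    ⟦ -[1+ m ] ℤ.* j ⟧          ≡⟨ ≡.cong ⟦_⟧ (ℤP.neg-distribˡ-* (+ suc m) j) ⟨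
    ⟦ ℤ.- (+ suc m ℤ.* j) ⟧     ≈⟨ ⟦⟧-neg (+ suc m ℤ.* j) ⟩
    - ⟦ + suc m ℤ.* j ⟧         ≈⟨ -‿cong (⟦⟧-*-+ (suc m) j) ⟩
    - (ι (suc m) * ⟦ j ⟧)       ≈⟨ -‿distribˡ-* _ _ ⟩
    - ι (suc m) * ⟦ j ⟧         ∎

  private
    almostCommutativeRing : ACR.AlmostCommutativeRing c ℓ
    almostCommutativeRing = ACR.fromCommutativeRing R

    homomorphism : ℤ.+-*-rawRing -Raw-AlmostCommutative⟶ almostCommutativeRing
    homomorphism = record
      { ⟦_⟧    = ⟦_⟧
      ; +-homo = ⟦⟧-+
      ; *-homo = ⟦⟧-*
      ; -‿homo = ⟦⟧-neg
      ; 0-homo = refl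
      ; 1-homo = refl
      }

    -- Only a semi-decision: distinct integers may have equal images, for instance in characteristic
    -- p, so a negative answer carries no information.
    _coeff≟_ : ∀ i j → Maybe (⟦ i ⟧ ≈ ⟦ j ⟧)
    i coeff≟ j with i ℤP.≟ j
    ... | yes ≡.refl = just refl
    ... | no  _      = nothing

  open import Algebra.Solver.Ring ℤ.+-*-rawRing almostCommutativeRing homomorphism _coeff≟_ public
    using (solve; con; _:+_; _:*_; _:-_; :-_; _:^_; _:=_)

-- Finite sums and the binomial theorem.

module FiniteSums {c ℓ} (R : CommutativeRing c ℓ) where

  open CommutativeRing R hiding (zero)
  open IntegerMultiples R
  open import Algebra.Properties.CommutativeSemiring.Exp commutativeSemiring using (_^_)
  open import Algebra.Properties.Semiring.Sum semiring
    using (sum; sum-cong-≋; sum-replicate-zero; sum-replicate; *-distribˡ-sum; ∑-comm)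
  open import Algebra.Properties.Semiring.Mult semiring
    using () renaming (_×_ to _×ᵤ_; ×-congʳ to ×ᵤ-congʳ; ×-assoc-* to ×ᵤ-assoc-*)
  import Algebra.Properties.Semiring.Mult.TCOptimised semiring as Mult
  open import Relation.Binary.Reasoning.Setoid setoid

  opaque
    -- The summand takes a natural number because the index also occurs in exponents and binomial
    -- coefficients. Opacity keeps sums from unfolding when they are compared.
    ∑< : ℕ → (ℕ → Carrier) → Carrier
    ∑< N f = sum (λ i → f (toℕ {N} i))

    ∑-cong : ∀ N {f g} → (∀ {i} → i < N → f i ≈ g i) → ∑< N f ≈ ∑< N g
    ∑-cong N f≈g = sum-cong-≋ (λ i → f≈g (toℕ<n i))

    ∑-zero : ∀ N {f} → (∀ {i} → i < N → f i ≈ 0#) → ∑< N f ≈ 0#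
    ∑-zero N f≈0 = trans (∑-cong N f≈0) (sum-replicate-zero N)

    ∑-ones : ∀ N {f} → (∀ {i} → i < N → f i ≈ 1#) → ∑< N f ≈ ι N
    ∑-ones N f≈1 = trans (∑-cong N f≈1) (trans (sum-replicate N) (Mult.×ᵤ≈× N 1#))

    ∑-snoc : ∀ N f → ∑< (suc N) f ≈ ∑< N f + f N
    ∑-snoc zero    f = +-comm (f 0) 0#
    ∑-snoc (suc N) f = begin
      f 0 + ∑< (suc N) (f ∘ suc)              ≈⟨ +-congˡ (∑-snoc N (f ∘ suc)) ⟩
      f 0 + (∑< N (f ∘ suc) + f (suc N))      ≈⟨ +-assoc _ _ _ ⟨
      f 0 + ∑< N (f ∘ suc) + f (suc N)        ∎

    ∑-single : ∀ {N j} f → j < N → (∀ {i} → i < N → i ≢ j → f i ≈ 0#) → ∑< N f ≈ f j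
    ∑-single {suc N} {zero} f _ f≈0 = begin
      f 0 + ∑< N (f ∘ suc)  ≈⟨ +-congˡ (∑-zero N (λ i<N → f≈0 (s<s i<N) λ ())) ⟩
      f 0 + 0#              ≈⟨ +-identityʳ _ ⟩
      f 0                   ∎
    ∑-single {suc N} {suc j} f j<N f≈0 = begin
      f 0 + ∑< N (f ∘ suc)  ≈⟨ +-cong (f≈0 z<s λ ()) (∑-single (f ∘ suc) (ℕ.s<s⁻¹ j<N)
                                 (λ i<N i≢j → f≈0 (s<s i<N) (i≢j ∘ ℕP.suc-injective))) ⟩
      0# + f (suc j)        ≈⟨ +-identityˡ _ ⟩
      f (suc j)             ∎

    ∑-extend : ∀ M d f → (∀ {i} → M ≤ i → f i ≈ 0#) → ∑< (M ℕ.+ d) f ≈ ∑< M f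
    ∑-extend zero    d f f≈0 = ∑-zero d (λ {i} _ → f≈0 {i} z≤n)
    ∑-extend (suc M) d f f≈0 = +-congˡ (∑-extend M d (f ∘ suc) (λ M≤i → f≈0 (s≤s M≤i)))

    ∑-suc : ∀ N f → ∑< (suc N) f ≈ f 0 + ∑< N (f ∘ suc)
    ∑-suc N f = refl

    *-∑ : ∀ N x f → x * ∑< N f ≈ ∑< N (λ i → x * f i)
    *-∑ N x f = *-distribˡ-sum {N} x _

    ∑-swap : ∀ M N (f : ℕ → ℕ → Carrier) → ∑< M (λ i → ∑< N (f i)) ≈ ∑< N (λ j → ∑< M (λ i → f i j))
    ∑-swap M N f = ∑-comm {M} {N} _

    binomialTheorem : ∀ x y N → (x + y) ^ N ≈ ∑< (suc N) (λ i → (N C i) ×ᵤ (x ^ i * y ^ (N ∸ i)))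
    binomialTheorem x y N = Binomial.theorem commutativeSemiring N x y

  binomial : ∀ x y N → (x + y) ^ N ≈ ∑< (suc N) (λ i → ι (N C i) * (x ^ i * y ^ (N ∸ i)))
  binomial x y N = trans (binomialTheorem x y N) (∑-cong (suc N) (λ {i} _ → begin
    (N C i) ×ᵤ (x ^ i * y ^ (N ∸ i))          ≈⟨ ×ᵤ-congʳ (N C i) (*-identityˡ _) ⟨
    (N C i) ×ᵤ (1# * (x ^ i * y ^ (N ∸ i)))   ≈⟨ ×ᵤ-assoc-* (N C i) 1# _ ⟨
    ((N C i) ×ᵤ 1#) * (x ^ i * y ^ (N ∸ i))   ≈⟨ *-congʳ (Mult.×ᵤ≈× (N C i) 1#) ⟩
    ι (N C i) * (x ^ i * y ^ (N ∸ i))         ∎))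

-- Arithmetic modulo an odd prime: inverses and Fermat's little theorem.

private
  coprime-of-∤ : ∀ {p k} → Prime p → ¬ p ℕ∣.∣ k → Coprime.Coprime p k
  coprime-of-∤ p-prime p∤k (d∣p , d∣k) with prime⇒irreducible p-prime d∣p
  ... | inj₁ d≡1     = d≡1
  ... | inj₂ ≡.refl  = contradiction d∣k p∤k

-- The last two hypotheses make `ι` a surjection that kills p, so the ring is a quotient of ℤ/p.
-- Writing p as 2n + 1 turns (p-1)/2 into the variable n.
module PrimeCharacteristic {ℓ₁ ℓ₂} (R : CommutativeRing ℓ₁ ℓ₂) (n : ℕ)
  (p-prime : Prime (suc (n ℕ.* 2)))
  (0<n : 0 < n)
  (ι-p : CommutativeRing._≈_ R (IntegerMultiples.ι R (suc (n ℕ.* 2))) (CommutativeRing.0# R))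
  (represent : ∀ x → ∃ λ r → CommutativeRing._≈_ R x (IntegerMultiples.ι R r))
  where

  open CommutativeRing R hiding (zero)
  open IntegerMultiples R
  open FiniteSums R
  open import Algebra.Properties.CommutativeSemiring.Exp commutativeSemiring
  open import Algebra.Properties.Ring ring
  open import Relation.Binary.Reasoning.Setoid setoid

  p : ℕ
  p = suc (n ℕ.* 2)

  ι-inverse : ∀ {k} → ¬ p ℕ∣.∣ k → ∃ λ u → u * ι k ≈ 1#
  ι-inverse {k} p∤k with Coprime.coprime-Bézout (coprime-of-∤ p-prime p∤k)
  ... | Bézout.+- x y eq = - ι y , (begin
    - ι y * ι k                    ≈⟨ solve 2 (λ a b → :- a :* b := con (+ 1) :- (con (+ 1) :+ a :* b)) refl (ι y) (ι k) ⟩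
    1# - (1# + ι y * ι k)          ≈⟨ +-congˡ (-‿cong (begin
      1# + ι y * ι k               ≈⟨ +-congˡ (ι-* y k) ⟨
      1# + ι (y ℕ.* k)             ≈⟨ ι-suc (y ℕ.* k) ⟨
      ι (suc (y ℕ.* k))            ≡⟨ ≡.cong ι eq ⟩
      ι (x ℕ.* p)                  ≈⟨ ι-* x p ⟩
      ι x * ι p                    ≈⟨ *-congˡ ι-p ⟩
      ι x * 0#                     ∎)) ⟩
    1# - ι x * 0#                  ≈⟨ solve 1 (λ a → con (+ 1) :- a :* con (+ 0) := con (+ 1)) refl (ι x) ⟩
    1#                             ∎)
  ... | Bézout.-+ x y eq = ι y , (begin
    ι y * ι k             ≈⟨ ι-* y k ⟨
    ι (y ℕ.* k)           ≡⟨ ≡.cong ι eq ⟨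
    ι (suc (x ℕ.* p))     ≈⟨ ι-suc (x ℕ.* p) ⟩
    1# + ι (x ℕ.* p)      ≈⟨ +-congˡ (ι-* x p) ⟩
    1# + ι x * ι p        ≈⟨ +-congˡ (*-congˡ ι-p) ⟩
    1# + ι x * 0#         ≈⟨ solve 1 (λ a → con (+ 1) :+ a :* con (+ 0) := con (+ 1)) refl (ι x) ⟩
    1#                    ∎)

  -- The substitute for division: inductions on power sums and binomial coefficients yield equations
  -- multiplied by some k + 1 < p, and that factor is then removed here.
  ι-cancel : ∀ {k x y} → ¬ p ℕ∣.∣ k → ι k * x ≈ ι k * y → x ≈ y
  ι-cancel {k} {x} {y} p∤k kx≈ky with u , uk≈1 ← ι-inverse p∤k = begin
    x               ≈⟨ *-identityˡ x ⟨
    1# * x          ≈⟨ *-congʳ uk≈1 ⟨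
    u * ι k * x     ≈⟨ *-assoc _ _ _ ⟩
    u * (ι k * x)   ≈⟨ *-congˡ kx≈ky ⟩
    u * (ι k * y)   ≈⟨ *-assoc _ _ _ ⟨
    u * ι k * y     ≈⟨ *-congʳ uk≈1 ⟩
    1# * y          ≈⟨ *-identityˡ y ⟩
    y               ∎

  ∤-suc : ∀ {k} → suc k < p → ¬ p ℕ∣.∣ suc k
  ∤-suc k<p = ℕ∣.>⇒∤ k<p

  ι[n*2] : ι (n ℕ.* 2) ≈ - 1#
  ι[n*2] = begin
    ι (n ℕ.* 2)                  ≈⟨ solve 1 (λ a → a := (con (+ 1) :+ a) :- con (+ 1)) refl _ ⟩
    (1# + ι (n ℕ.* 2)) - 1#      ≈⟨ +-congʳ (ι-suc (n ℕ.* 2)) ⟨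
    ι p - 1#                     ≈⟨ +-congʳ ι-p ⟩
    0# - 1#                      ≈⟨ +-identityˡ _ ⟩
    - 1#                         ∎

  1^ : ∀ m → 1# ^ m ≈ 1#
  1^ zero    = refl
  1^ (suc m) = trans (*-identityˡ _) (1^ m)

  0^ : ∀ {m} → 0 < m → 0# ^ m ≈ 0#
  0^ {suc m} _ = zeroˡ _

  ι-C-p : ∀ {i} → i < n ℕ.* 2 → ι (p C suc i) ≈ 0#
  ι-C-p {i} i<2n = ι-cancel (∤-suc (s<s i<2n)) (begin
    ι (suc i) * ι (p C suc i)     ≈⟨ ι-* (suc i) (p C suc i) ⟨
    ι (suc i ℕ.* (p C suc i))     ≡⟨ ≡.cong ι (C-absorb (n ℕ.* 2) i) ⟩
    ι (p ℕ.* ((n ℕ.* 2) C i))     ≈⟨ ι-* p ((n ℕ.* 2) C i) ⟩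
    ι p * ι ((n ℕ.* 2) C i)       ≈⟨ *-congʳ ι-p ⟩
    0# * ι ((n ℕ.* 2) C i)        ≈⟨ zeroˡ _ ⟩
    0#                            ≈⟨ zeroʳ _ ⟨
    ι (suc i) * 0#                ∎)

  -- The case of adding 1 is enough for Fermat: induction reaches every `ι m`, and every ring
  -- element is of that form.
  frobenius-suc : ∀ y → (y + 1#) ^ p ≈ y ^ p + 1#
  frobenius-suc y = begin
    (y + 1#) ^ p                                ≈⟨ binomial y 1# p ⟩
    ∑< (suc p) f                                ≈⟨ ∑-suc p f ⟩
    f 0 + ∑< p (f ∘ suc)                        ≈⟨ +-congˡ (∑-snoc (n ℕ.* 2) (f ∘ suc)) ⟩
    f 0 + (∑< (n ℕ.* 2) (f ∘ suc) + f p)        ≈⟨ +-cong f0 (+-cong (∑-zero (n ℕ.* 2) middle) fp) ⟩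
    1# + (0# + y ^ p)                           ≈⟨ solve 1 (λ a → con (+ 1) :+ (con (+ 0) :+ a) := a :+ con (+ 1)) refl (y ^ p) ⟩
    y ^ p + 1#                                  ∎
    where
    f : ℕ → Carrier
    f i = ι (p C i) * (y ^ i * 1# ^ (p ∸ i))
    f0 : f 0 ≈ 1#
    f0 = begin
      ι (p C 0) * (1# * 1# ^ p)   ≈⟨ *-cong (reflexive (≡.cong ι (C-zero p))) (*-congˡ (1^ p)) ⟩
      1# * (1# * 1#)              ≈⟨ trans (*-identityˡ _) (*-identityˡ _) ⟩
      1#                          ∎
    fp : f p ≈ y ^ p
    fp = begin
      ι (p C p) * (y ^ p * 1# ^ (p ∸ p))  ≈⟨ *-cong (reflexive (≡.cong ι (nCn≡1 p))) (*-congˡ (1^ (p ∸ p))) ⟩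
      1# * (y ^ p * 1#)                   ≈⟨ trans (*-identityˡ _) (*-identityʳ _) ⟩
      y ^ p                               ∎
    middle : ∀ {i} → i < n ℕ.* 2 → f (suc i) ≈ 0#
    middle i<2n = trans (*-congʳ (ι-C-p i<2n)) (zeroˡ _)

  ι^p : ∀ m → ι m ^ p ≈ ι m
  ι^p zero    = 0^ {p} z<s
  ι^p (suc m) = begin
    ι (suc m) ^ p    ≈⟨ ^-congˡ p (trans (ι-suc m) (+-comm _ _)) ⟩
    (ι m + 1#) ^ p   ≈⟨ frobenius-suc (ι m) ⟩
    ι m ^ p + 1#     ≈⟨ +-congʳ (ι^p m) ⟩
    ι m + 1#         ≈⟨ trans (+-comm _ _) (sym (ι-suc m)) ⟩
    ι (suc m)        ∎

  x^p : ∀ x → x ^ p ≈ x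
  x^p x with r , x≈r ← represent x = begin
    x ^ p    ≈⟨ ^-congˡ p x≈r ⟩
    ι r ^ p  ≈⟨ ι^p r ⟩
    ι r      ≈⟨ x≈r ⟨
    x        ∎

  fermat : ∀ {k} → ¬ p ℕ∣.∣ k → ι k ^ (n ℕ.* 2) ≈ 1#
  -- As p is the successor of 2n, `ι k ^ p` is by definition `ι k` times the power in question.
  fermat {k} p∤k = ι-cancel p∤k (trans (ι^p k) (sym (*-identityʳ _)))

  -- Sums over all residues and their invariance under translation.

  Congruent : (Carrier → Carrier) → Set _
  Congruent f = ∀ {x y} → x ≈ y → f x ≈ f y

  opaque
    ∑ₚ : (Carrier → Carrier) → Carrier
    ∑ₚ f = ∑< p (f ∘ ι)

    ∑ₚ-∑ : ∀ f → ∑ₚ f ≈ ∑< p (f ∘ ι)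
    ∑ₚ-∑ f = refl

    ∑ₚ-cong : ∀ {f g} → (∀ x → f x ≈ g x) → ∑ₚ f ≈ ∑ₚ g
    ∑ₚ-cong f≈g = ∑-cong p (λ {i} _ → f≈g (ι i))

    ∑ₚ-* : ∀ x f → ∑ₚ (λ y → x * f y) ≈ x * ∑ₚ f
    ∑ₚ-* x f = sym (*-∑ p x (f ∘ ι))

    -- With f(0) added, both sides become the sum of f over 0, ..., p: the shifted sum lacks the
    -- first term, and the unshifted one lacks the last, which is f(p) = f(0).
    ∑ₚ-suc : ∀ {f} → Congruent f → ∑ₚ (λ y → f (y + 1#)) ≈ ∑ₚ f
    ∑ₚ-suc {f} f-cong = +-cancelˡ (f 0#) _ _ (begin
      f 0# + ∑ₚ (λ y → f (y + 1#))      ≈⟨ +-congˡ (∑-cong p (λ {i} _ → f-cong (trans (+-comm _ _) (sym (ι-suc i))))) ⟩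
      f 0# + ∑< p (f ∘ ι ∘ suc)        ≈⟨ ∑-suc p (f ∘ ι) ⟨
      ∑< (suc p) (f ∘ ι)               ≈⟨ ∑-snoc p (f ∘ ι) ⟩
      ∑ₚ f + f (ι p)                    ≈⟨ +-congˡ (f-cong ι-p) ⟩
      ∑ₚ f + f 0#                       ≈⟨ +-comm _ _ ⟩
      f 0# + ∑ₚ f                       ∎)

    ∑ₚ-∑-swap : ∀ N (f : ℕ → Carrier → Carrier) → ∑ₚ (λ y → ∑< N (λ i → f i y)) ≈ ∑< N (λ i → ∑ₚ (f i))
    ∑ₚ-∑-swap N f = ∑-swap p N (λ x i → f i (ι x))

  ∑ₚ-shift-ι : ∀ {f} → Congruent f → ∀ r → ∑ₚ (λ y → f (y + ι r)) ≈ ∑ₚ f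
  ∑ₚ-shift-ι f-cong zero = ∑ₚ-cong (λ x → f-cong (+-identityʳ x))
  ∑ₚ-shift-ι {f} f-cong (suc r) = begin
    ∑ₚ (λ y → f (y + ι (suc r)))      ≈⟨ ∑ₚ-cong (λ x → f-cong (trans (+-congˡ (ι-suc r)) (sym (+-assoc _ _ _)))) ⟩
    ∑ₚ (λ y → f ((y + 1#) + ι r))     ≈⟨ ∑ₚ-suc {λ y → f (y + ι r)} (λ x≈y → f-cong (+-congʳ x≈y)) ⟩
    ∑ₚ (λ y → f (y + ι r))            ≈⟨ ∑ₚ-shift-ι f-cong r ⟩
    ∑ₚ f                              ∎

  ∑ₚ-shift : ∀ {f} → Congruent f → ∀ c → ∑ₚ (λ y → f (y + c)) ≈ ∑ₚ f
  ∑ₚ-shift {f} f-cong c with r , c≈r ← represent c =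
    trans (∑ₚ-cong (λ x → f-cong (+-congˡ c≈r))) (∑ₚ-shift-ι f-cong r)

  -- The weight h carries the factors that stay unexpanded, so a product of n-th powers can be
  -- opened one factor at a time.
  ∑ₚ-binomial : ∀ (h a b : Carrier → Carrier) N → ∑ₚ (λ y → h y * (a y + b y) ^ N)
             ≈ ∑< (suc N) (λ i → ι (N C i) * ∑ₚ (λ y → h y * (a y ^ i * b y ^ (N ∸ i))))
  ∑ₚ-binomial h a b N = begin
    ∑ₚ (λ y → h y * (a y + b y) ^ N)
      ≈⟨ ∑ₚ-cong (λ y → begin
        h y * (a y + b y) ^ N
          ≈⟨ *-congˡ (binomial (a y) (b y) N) ⟩
        h y * ∑< (suc N) (λ i → ι (N C i) * (a y ^ i * b y ^ (N ∸ i)))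
          ≈⟨ *-∑ (suc N) (h y) _ ⟩
        ∑< (suc N) (λ i → h y * (ι (N C i) * (a y ^ i * b y ^ (N ∸ i))))
          ≈⟨ ∑-cong (suc N) (λ {i} _ → solve 3 (λ h c m → h :* (c :* m) := c :* (h :* m)) refl (h y) (ι (N C i)) (a y ^ i * b y ^ (N ∸ i))) ⟩
        ∑< (suc N) (λ i → ι (N C i) * (h y * (a y ^ i * b y ^ (N ∸ i)))) ∎) ⟩
    ∑ₚ (λ y → ∑< (suc N) (λ i → ι (N C i) * (h y * (a y ^ i * b y ^ (N ∸ i)))))
      ≈⟨ ∑ₚ-∑-swap (suc N) _ ⟩
    ∑< (suc N) (λ i → ∑ₚ (λ y → ι (N C i) * (h y * (a y ^ i * b y ^ (N ∸ i)))))
      ≈⟨ ∑-cong (suc N) (λ {i} _ → ∑ₚ-* (ι (N C i)) _) ⟩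
    ∑< (suc N) (λ i → ι (N C i) * ∑ₚ (λ y → h y * (a y ^ i * b y ^ (N ∸ i)))) ∎

  -- Power sums modulo p.

  powerSum : ℕ → Carrier
  powerSum m = ∑ₚ (_^ m)

  -- Translation by 1 leaves the sum of the (m+1)-st powers unchanged. Expanding (y+1)^(m+1) and
  -- cancelling that sum leaves (m+1) times the m-th power sum plus lower ones, which vanish by
  -- strong induction; m + 1 < p then cancels.
  powerSum-small : ∀ m → m < n ℕ.* 2 → powerSum m ≈ 0#
  powerSum-small = <-rec (λ m → m < n ℕ.* 2 → powerSum m ≈ 0#) step
    where
    step : ∀ m → (∀ {i} → i < m → i < n ℕ.* 2 → powerSum i ≈ 0#) → m < n ℕ.* 2 → powerSum m ≈ 0#
    step m powerSum-lower m<2n = ι-cancel (∤-suc (s<s m<2n)) (trans (+-cancelʳ (powerSum (suc m)) _ _ (begin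
      ι (suc m) * powerSum m + powerSum (suc m)          ≈⟨ +-cong (sym (fi≈ m (ι (suc m)) [1+m]Cm)) (sym (trans (fi≈ (suc m) 1# (≡.cong ι (nCn≡1 (suc m)))) (*-identityˡ _))) ⟩
      f m + f (suc m)                      ≈⟨ +-congʳ (+-identityˡ _) ⟨
      0# + f m + f (suc m)                 ≈⟨ +-congʳ (+-congʳ (∑-zero m lower)) ⟨
      ∑< m f + f m + f (suc m)             ≈⟨ +-congʳ (∑-snoc m f) ⟨
      ∑< (suc m) f + f (suc m)             ≈⟨ ∑-snoc (suc m) f ⟨
      ∑< (suc (suc m)) f                   ≈⟨ ∑ₚ-binomial (λ _ → 1#) (λ y → y) (λ _ → 1#) (suc m) ⟨
      ∑ₚ (λ y → 1# * (y + 1#) ^ suc m)      ≈⟨ ∑ₚ-cong (λ y → *-identityˡ _) ⟩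
      ∑ₚ (λ y → (y + 1#) ^ suc m)           ≈⟨ ∑ₚ-suc {_^ suc m} (^-congˡ (suc m)) ⟩
      powerSum (suc m)                            ≈⟨ +-identityˡ _ ⟨
      0# + powerSum (suc m)                       ∎)) (sym (zeroʳ _)))
      where
      f : ℕ → Carrier
      f i = ι (suc m C i) * ∑ₚ (λ y → 1# * (y ^ i * 1# ^ (suc m ∸ i)))
      fi≈ : ∀ i x → ι (suc m C i) ≡ x → f i ≈ x * powerSum i
      fi≈ i _ ≡.refl = *-congˡ (∑ₚ-cong (λ y → trans (*-identityˡ _) (trans (*-congˡ (1^ (suc m ∸ i))) (*-identityʳ _))))
      [1+m]Cm : ι (suc m C m) ≡ ι (suc m)
      [1+m]Cm = ≡.cong ι (≡.trans (nCk≡nC[n∸k] (ℕP.n≤1+n m))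
        (≡.trans (≡.cong (suc m C_) (ℕP.m+n∸n≡m 1 m)) (nC1≡n (suc m))))
      lower : ∀ {i} → i < m → f i ≈ 0#
      lower {i} i<m = begin
        f i                      ≈⟨ fi≈ i _ ≡.refl ⟩
        ι (suc m C i) * powerSum i      ≈⟨ *-congˡ (powerSum-lower i<m (ℕP.<-trans i<m m<2n)) ⟩
        ι (suc m C i) * 0#       ≈⟨ zeroʳ _ ⟩
        0#                       ∎

  -- The term at 0 vanishes because the exponent is positive; by Fermat each of the other 2n terms
  -- is 1, and 2n = -1.
  powerSum-top : powerSum (n ℕ.* 2) ≈ - 1#
  powerSum-top = begin
    powerSum (n ℕ.* 2)                                               ≈⟨ ∑ₚ-∑ _ ⟩
    ∑< p (λ i → ι i ^ (n ℕ.* 2))                              ≈⟨ ∑-suc (n ℕ.* 2) _ ⟩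
    0# ^ (n ℕ.* 2) + ∑< (n ℕ.* 2) (λ i → ι (suc i) ^ (n ℕ.* 2))
      ≈⟨ +-cong (0^ (ℕP.*-monoˡ-< 2 0<n)) (∑-ones (n ℕ.* 2) (λ i<2n → fermat (∤-suc (s<s i<2n)))) ⟩
    0# + ι (n ℕ.* 2)                                          ≈⟨ +-identityˡ _ ⟩
    ι (n ℕ.* 2)                                               ≈⟨ ι[n*2] ⟩
    - 1#                                                      ∎

  -- The exponent has to be positive: y^p = y trades p factors for one. For exponent 0 the period
  -- would fail, as the sum there is p = 0 but at 2n it is -1.
  powerSum-period : ∀ m → powerSum (suc m ℕ.+ n ℕ.* 2) ≈ powerSum (suc m)
  powerSum-period m = ∑ₚ-cong (λ y → begin
    y ^ (suc m ℕ.+ n ℕ.* 2)   ≡⟨ ≡.cong (y ^_) (ℕP.+-suc m (n ℕ.* 2)) ⟨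
    y ^ (m ℕ.+ p)             ≈⟨ ^-homo-* y m p ⟩
    y ^ m * y ^ p             ≈⟨ *-congˡ (x^p y) ⟩
    y ^ m * y                 ≈⟨ *-comm _ _ ⟩
    y ^ suc m                 ∎)

  -- Above 2n one period leads back to a positive exponent below 2n. The bound is sharp, since from
  -- 4n one period leads to 2n itself.
  powerSum-zero : ∀ {e} → e < n ℕ.* 2 ℕ.+ n ℕ.* 2 → e ≢ n ℕ.* 2 → powerSum e ≈ 0#
  powerSum-zero {e} e<4n e≢2n with ℕP.<-cmp e (n ℕ.* 2)
  ... | tri< e<2n _ _ = powerSum-small e e<2n
  ... | tri≈ _ e≡2n _ = contradiction e≡2n e≢2n
  ... | tri> _ _ e>2n with m , 1+2n+m≡e ← ℕP.m≤n⇒∃[o]m+o≡n e>2n = begin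
    powerSum e                        ≡⟨ ≡.cong powerSum e≡ ⟩
    powerSum (suc m ℕ.+ n ℕ.* 2)      ≈⟨ powerSum-period m ⟩
    powerSum (suc m)                  ≈⟨ powerSum-small (suc m) (ℕP.+-cancelʳ-< (n ℕ.* 2) _ _ (≡.subst (_< n ℕ.* 2 ℕ.+ n ℕ.* 2) e≡ e<4n)) ⟩
    0#                         ∎
    where
    e≡ : e ≡ suc m ℕ.+ n ℕ.* 2
    e≡ = ≡.trans (≡.sym 1+2n+m≡e) (≡.cong suc (ℕP.+-comm (n ℕ.* 2) m))

  -- Coefficient extraction. The exponents m + i with i ≤ n are at most 3n < 4n, so only i = j
  -- contributes, with factor -1. If j > n no term contributes; then n C j is 0, which makes the
  -- truncated exponent on the right harmless.
  ∑ₚ-^-*-[+]^ : ∀ m j c → m ℕ.+ j ≡ n ℕ.* 2 →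
               ∑ₚ (λ y → y ^ m * (y + c) ^ n) ≈ - (ι (n C j) * c ^ (n ∸ j))
  ∑ₚ-^-*-[+]^ m j c m+j≡2n = trans (∑ₚ-binomial (_^ m) (λ y → y) (λ _ → c) n) (by-cases (ℕP.<-≤-connex n j))
    where
    f : ℕ → Carrier
    f i = ι (n C i) * ∑ₚ (λ y → y ^ m * (y ^ i * c ^ (n ∸ i)))
    f≈ : ∀ i → f i ≈ ι (n C i) * (c ^ (n ∸ i) * powerSum (m ℕ.+ i))
    f≈ i = *-congˡ (begin
      ∑ₚ (λ y → y ^ m * (y ^ i * c ^ (n ∸ i)))   ≈⟨ ∑ₚ-cong (λ y → begin
        y ^ m * (y ^ i * c ^ (n ∸ i))           ≈⟨ solve 3 (λ a b c → a :* (b :* c) := c :* (a :* b)) refl (y ^ m) (y ^ i) (c ^ (n ∸ i)) ⟩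
        c ^ (n ∸ i) * (y ^ m * y ^ i)           ≈⟨ *-congˡ (^-homo-* y m i) ⟨
        c ^ (n ∸ i) * y ^ (m ℕ.+ i)             ∎) ⟩
      ∑ₚ (λ y → c ^ (n ∸ i) * y ^ (m ℕ.+ i))     ≈⟨ ∑ₚ-* _ _ ⟩
      c ^ (n ∸ i) * powerSum (m ℕ.+ i)                 ∎)
    f≈0 : ∀ {i} → i < suc n → i ≢ j → f i ≈ 0#
    f≈0 {i} i≤n i≢j = begin
      f i                                              ≈⟨ f≈ i ⟩
      ι (n C i) * (c ^ (n ∸ i) * powerSum (m ℕ.+ i))          ≈⟨ *-congˡ (*-congˡ (powerSum-zero
        (ℕP.+-mono-≤-< (ℕP.m+n≤o⇒m≤o m (ℕP.≤-reflexive m+j≡2n))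
          (ℕP.≤-<-trans (ℕ.s≤s⁻¹ i≤n) (ℕP.m<m*n n 2 {{ℕ.>-nonZero 0<n}} (s<s z<s))))
        (λ m+i≡2n → i≢j (ℕP.+-cancelˡ-≡ m i j (≡.trans m+i≡2n (≡.sym m+j≡2n)))))) ⟩
      ι (n C i) * (c ^ (n ∸ i) * 0#)                   ≈⟨ trans (*-congˡ (zeroʳ _)) (zeroʳ _) ⟩
      0#                                               ∎
    by-cases : (n < j ⊎ j ≤ n) → ∑< (suc n) f ≈ - (ι (n C j) * c ^ (n ∸ j))
    by-cases (inj₁ n<j) = begin
      ∑< (suc n) f                     ≈⟨ ∑-zero (suc n) (λ i≤n → f≈0 i≤n (ℕP.<⇒≢ (ℕP.≤-<-trans (ℕ.s≤s⁻¹ i≤n) n<j))) ⟩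
      0#                               ≈⟨ solve 1 (λ a → con (+ 0) := :- (con (+ 0) :* a)) refl (c ^ (n ∸ j)) ⟩
      - (0# * c ^ (n ∸ j))             ≡⟨ ≡.cong (λ k → - (ι k * c ^ (n ∸ j))) (k>n⇒nCk≡0 n<j) ⟨
      - (ι (n C j) * c ^ (n ∸ j))      ∎
    by-cases (inj₂ j≤n) = begin
      ∑< (suc n) f                                   ≈⟨ ∑-single f (s≤s j≤n) f≈0 ⟩
      f j                                            ≈⟨ f≈ j ⟩
      ι (n C j) * (c ^ (n ∸ j) * powerSum (m ℕ.+ j))        ≈⟨ *-congˡ (*-congˡ (trans (reflexive (≡.cong powerSum m+j≡2n)) powerSum-top)) ⟩
      ι (n C j) * (c ^ (n ∸ j) * - 1#)               ≈⟨ solve 2 (λ a b → a :* (b :* :- con (+ 1)) := :- (a :* b)) refl (ι (n C j)) (c ^ (n ∸ j)) ⟩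
      - (ι (n C j) * c ^ (n ∸ j))                    ∎

  -- Binomial coefficients modulo p.

  ι-C-step : ∀ N k → ι (suc k) * ι (N C suc k) ≈ (ι N - ι k) * ι (N C k)
  ι-C-step N k = begin
    ι (suc k) * ι (N C suc k)
      ≈⟨ solve 3 (λ a b c → a := (a :+ b :* c) :- b :* c) refl (ι (suc k) * ι (N C suc k)) (ι k) (ι (N C k)) ⟩
    (ι (suc k) * ι (N C suc k) + ι k * ι (N C k)) - ι k * ι (N C k)
      ≈⟨ +-congʳ (begin
        ι (suc k) * ι (N C suc k) + ι k * ι (N C k)          ≈⟨ +-cong (ι-* (suc k) (N C suc k)) (ι-* k (N C k)) ⟨
        ι (suc k ℕ.* (N C suc k)) + ι (k ℕ.* (N C k))        ≈⟨ ι-+ (suc k ℕ.* (N C suc k)) (k ℕ.* (N C k)) ⟨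
        ι (suc k ℕ.* (N C suc k) ℕ.+ k ℕ.* (N C k))          ≡⟨ ≡.cong ι (C-step N k) ⟩
        ι (N ℕ.* (N C k))                                    ≈⟨ ι-* N (N C k) ⟩
        ι N * ι (N C k)                                      ∎) ⟩
    ι N * ι (N C k) - ι k * ι (N C k)
      ≈⟨ solve 3 (λ a b c → a :* c :- b :* c := (a :- b) :* c) refl (ι N) (ι k) (ι (N C k)) ⟩
    (ι N - ι k) * ι (N C k) ∎

  -- Upper negation: 2n = -1 gives N = -1 - a, and C(-1-a,b) = (-1)^b C(a+b,b). Both sides obey the
  -- same recurrence in b, whose factor b + 1 is cancellable while it is below p.
  C-negate : ∀ {N} a b → N ℕ.+ a ≡ n ℕ.* 2 → b < p →
             ι (N C b) ≈ (- 1#) ^ b * ι ((a ℕ.+ b) C b)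
  C-negate {N} a zero _ _ = begin
    ι (N C 0)                    ≡⟨ ≡.cong ι (C-zero N) ⟩
    1#                           ≈⟨ *-identityˡ _ ⟨
    1# * 1#                      ≡⟨ ≡.cong (λ k → 1# * ι k) (C-zero (a ℕ.+ 0)) ⟨
    1# * ι ((a ℕ.+ 0) C 0)       ∎
  C-negate {N} a (suc b) N+a≡2n b<p = ι-cancel (∤-suc b<p) (begin
    ι (suc b) * ι (N C suc b)
      ≈⟨ ι-C-step N b ⟩
    (ι N - ι b) * ι (N C b)
      ≈⟨ *-cong (+-congʳ N≈) (C-negate a b N+a≡2n (ℕP.<-trans (ℕP.n<1+n b) b<p)) ⟩
    ((- 1# - ι a) - ι b) * ((- 1#) ^ b * X)
      ≈⟨ solve 4 (λ a b s x → ((:- con (+ 1) :- a) :- b) :* (s :* x) := (:- con (+ 1) :* s) :* ((con (+ 1) :+ (a :+ b)) :* x)) refl (ι a) (ι b) ((- 1#) ^ b) X ⟩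
    (- 1#) ^ suc b * ((1# + (ι a + ι b)) * X)
      ≈⟨ *-congˡ (*-congʳ (trans (ι-suc (a ℕ.+ b)) (+-congˡ (ι-+ a b)))) ⟨
    (- 1#) ^ suc b * (ι (suc (a ℕ.+ b)) * X)
      ≈⟨ *-congˡ (ι-* (suc (a ℕ.+ b)) ((a ℕ.+ b) C b)) ⟨
    (- 1#) ^ suc b * ι (suc (a ℕ.+ b) ℕ.* ((a ℕ.+ b) C b))
      ≡⟨ ≡.cong (λ k → (- 1#) ^ suc b * ι k) (C-absorb (a ℕ.+ b) b) ⟨
    (- 1#) ^ suc b * ι (suc b ℕ.* (suc (a ℕ.+ b) C suc b))
      ≈⟨ *-congˡ (ι-* (suc b) (suc (a ℕ.+ b) C suc b)) ⟩
    (- 1#) ^ suc b * (ι (suc b) * ι (suc (a ℕ.+ b) C suc b))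
      ≈⟨ solve 3 (λ a b c → a :* (b :* c) := b :* (a :* c)) refl ((- 1#) ^ suc b) (ι (suc b)) (ι (suc (a ℕ.+ b) C suc b)) ⟩
    ι (suc b) * ((- 1#) ^ suc b * ι (suc (a ℕ.+ b) C suc b))
      ≡⟨ ≡.cong (λ k → ι (suc b) * ((- 1#) ^ suc b * ι (k C suc b))) (ℕP.+-suc a b) ⟨
    ι (suc b) * ((- 1#) ^ suc b * ι ((a ℕ.+ suc b) C suc b)) ∎)
    where
    X : Carrier
    X = ι ((a ℕ.+ b) C b)
    N≈ : ι N ≈ - 1# - ι a
    N≈ = begin
      ι N                    ≈⟨ solve 2 (λ a b → a := (a :+ b) :- b) refl (ι N) (ι a) ⟩
      (ι N + ι a) - ι a      ≈⟨ +-congʳ (ι-+ N a) ⟨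
      ι (N ℕ.+ a) - ι a      ≡⟨ ≡.cong (λ k → ι k - ι a) N+a≡2n ⟩
      ι (n ℕ.* 2) - ι a      ≈⟨ +-congʳ ι[n*2] ⟩
      - 1# - ι a             ∎

  n<p : n < p
  n<p = s≤s (ℕP.m≤m*n n 2)

  -- This is C(2k,k) = (-4)^k C(-1/2,k) with n = -1/2 modulo p. The consecutive ratios 2(2k+1)/(k+1)
  -- and -4(n-k)/(k+1) agree because 2n = -1.
  C-central-≈ : ∀ k → k ≤ n → ι ((2 ℕ.* k) C k) ≈ (- ι 4) ^ k * ι (n C k)
  C-central-≈ zero _ = begin
    1#                  ≈⟨ *-identityˡ _ ⟨
    1# * 1#             ≡⟨ ≡.cong (λ k → 1# * ι k) (C-zero n) ⟨
    1# * ι (n C 0)      ∎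
  C-central-≈ (suc k) k<n = ι-cancel (∤-suc (ℕP.≤-<-trans k<n n<p)) (begin
    ι (suc k) * ι ((2 ℕ.* suc k) C suc k)
      ≈⟨ ι-* (suc k) ((2 ℕ.* suc k) C suc k) ⟨
    ι (suc k ℕ.* ((2 ℕ.* suc k) C suc k))
      ≡⟨ ≡.cong ι (C-central k) ⟩
    ι (2 ℕ.* (suc (2 ℕ.* k) ℕ.* ((2 ℕ.* k) C k)))
      ≈⟨ trans (ι-* 2 (suc (2 ℕ.* k) ℕ.* ((2 ℕ.* k) C k))) (*-congˡ (ι-* (suc (2 ℕ.* k)) ((2 ℕ.* k) C k))) ⟩
    ι 2 * (ι (suc (2 ℕ.* k)) * ι ((2 ℕ.* k) C k))
      ≈⟨ *-congˡ (*-cong (trans (ι-suc (2 ℕ.* k)) (+-congˡ (ι-* 2 k))) (C-central-≈ k (ℕP.<⇒≤ k<n))) ⟩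
    ι 2 * ((1# + ι 2 * ι k) * (s * X))
      -- Splitting 2(1 + 2k) as (-4)(0 - k) + 2 isolates a 1, which the next step replaces by -2n to
      -- complete (-4)(n - k).
      ≈⟨ solve 3 (λ k s x → con (+ 2) :* ((con (+ 1) :+ con (+ 2) :* k) :* (s :* x)) := (:- con (+ 4) :* s) :* ((con (+ 0) :- k) :* x) :+ con (+ 2) :* (con (+ 1) :* (s :* x))) refl (ι k) s X ⟩
    (- ι 4 * s) * ((0# - ι k) * X) + ι 2 * (1# * (s * X))
      ≈⟨ +-congˡ (*-congˡ (*-congʳ (trans (sym (-‿involutive _)) (-‿cong (trans (sym ι[n*2]) (ι-* n 2)))))) ⟩
    (- ι 4 * s) * ((0# - ι k) * X) + ι 2 * (- (ι n * ι 2) * (s * X))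
      ≈⟨ solve 4 (λ n k s x → (:- con (+ 4) :* s) :* ((con (+ 0) :- k) :* x) :+ con (+ 2) :* (:- (n :* con (+ 2)) :* (s :* x)) := (:- con (+ 4) :* s) :* ((n :- k) :* x)) refl (ι n) (ι k) s X ⟩
    (- ι 4) ^ suc k * ((ι n - ι k) * X)
      ≈⟨ *-congˡ (ι-C-step n k) ⟨
    (- ι 4) ^ suc k * (ι (suc k) * ι (n C suc k))
      ≈⟨ solve 3 (λ a b c → a :* (b :* c) := b :* (a :* c)) refl ((- ι 4) ^ suc k) (ι (suc k)) (ι (n C suc k)) ⟩
    ι (suc k) * ((- ι 4) ^ suc k * ι (n C suc k)) ∎)
    where
    s X : Carrier
    s = (- ι 4) ^ k
    X = ι (n C k)

  [-x]^[2*m] : ∀ x m → (- x) ^ (2 ℕ.* m) ≈ x ^ (2 ℕ.* m)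
  [-x]^[2*m] x m = begin
    (- x) ^ (2 ℕ.* m)     ≈⟨ ^-assocʳ (- x) 2 m ⟨
    ((- x) ^ 2) ^ m       ≈⟨ ^-congˡ m (solve 1 (λ x → (:- x) :^ 2 := x :^ 2) refl x) ⟩
    (x ^ 2) ^ m           ≈⟨ ^-assocʳ x 2 m ⟩
    x ^ (2 ℕ.* m)         ∎

  -- Upper negation is used twice, with a reflection in between: first with lower index n, giving
  -- C(n+2k,n) = C(n+2k,2k), then backwards with lower index 2k, where the sign is even.
  C-[2n∸2k]-n : ∀ k → k ≤ n → ι ((2 ℕ.* n ∸ 2 ℕ.* k) C n) ≈ (- 1#) ^ n * ι (n C (2 ℕ.* k))
  C-[2n∸2k]-n k k≤n = begin
    ι ((2 ℕ.* n ∸ 2 ℕ.* k) C n)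
      ≈⟨ C-negate (2 ℕ.* k) n (≡.trans (ℕP.m∸n+n≡m 2k≤2n) (ℕP.*-comm 2 n)) n<p ⟩
    (- 1#) ^ n * ι ((2 ℕ.* k ℕ.+ n) C n)
      ≡⟨ ≡.cong (λ m → (- 1#) ^ n * ι m) flip ⟩
    (- 1#) ^ n * ι ((n ℕ.+ 2 ℕ.* k) C (2 ℕ.* k))
      ≈⟨ *-congˡ (trans (*-congʳ (trans ([-x]^[2*m] 1# k) (1^ (2 ℕ.* k)))) (*-identityˡ _)) ⟨
    (- 1#) ^ n * ((- 1#) ^ (2 ℕ.* k) * ι ((n ℕ.+ 2 ℕ.* k) C (2 ℕ.* k)))
      ≈⟨ *-congˡ (C-negate n (2 ℕ.* k) n+n≡2n (s≤s (≡.subst (2 ℕ.* k ≤_) (ℕP.*-comm 2 n) 2k≤2n))) ⟨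
    (- 1#) ^ n * ι (n C (2 ℕ.* k)) ∎
    where
    2k≤2n : 2 ℕ.* k ≤ 2 ℕ.* n
    2k≤2n = ℕP.*-monoʳ-≤ 2 k≤n
    n+n≡2n : n ℕ.+ n ≡ n ℕ.* 2
    n+n≡2n = ≡.trans (≡.cong (n ℕ.+_) (≡.sym (ℕP.+-identityʳ n))) (ℕP.*-comm 2 n)
    flip : (2 ℕ.* k ℕ.+ n) C n ≡ (n ℕ.+ 2 ℕ.* k) C (2 ℕ.* k)
    flip = ≡.trans (nCk≡nC[n∸k] (ℕP.m≤n+m n (2 ℕ.* k)))
      (≡.cong₂ _C_ (ℕP.+-comm (2 ℕ.* k) n) (ℕP.m+n∸n≡m (2 ℕ.* k) n))

  -- Euler's criterion.

  ⟦⟧-∣ : ∀ {i} → + p ℤ∣.∣ i → ⟦ i ⟧ ≈ 0#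
  ⟦⟧-∣ (ℤ∣.divides q ≡.refl) = trans (⟦⟧-* q (+ p)) (trans (*-congˡ ι-p) (zeroʳ _))

  fermat-ℤ : ∀ {i} → ¬ + p ℤ∣.∣ i → ⟦ i ⟧ ^ (n ℕ.* 2) ≈ 1#
  fermat-ℤ {+ k}      p∤i = fermat (p∤i ∘ ℤ∣.∣ᵤ⇒∣)
  fermat-ℤ { -[1+ k ]} p∤i = begin
    (- ι (suc k)) ^ (n ℕ.* 2)    ≡⟨ ≡.cong ((- ι (suc k)) ^_) (ℕP.*-comm n 2) ⟩
    (- ι (suc k)) ^ (2 ℕ.* n)    ≈⟨ [-x]^[2*m] (ι (suc k)) n ⟩
    ι (suc k) ^ (2 ℕ.* n)        ≡⟨ ≡.cong (ι (suc k) ^_) (ℕP.*-comm 2 n) ⟩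
    ι (suc k) ^ (n ℕ.* 2)        ≈⟨ fermat (p∤i ∘ ℤ∣.∣ᵤ⇒∣) ⟩
    1#                           ∎

  -- Cancelling y would require knowing that p does not divide it. Instead x · xⁿ = y · y^p = y² = x
  -- shows that xⁿ fixes every positive power of x, in particular xⁿ itself; but the square of xⁿ is
  -- 1.
  euler-square : ∀ {x} y → x ^ (n ℕ.* 2) ≈ 1# → y ^ 2 ≈ x → x ^ n ≈ 1#
  euler-square {x} y x^2n≈1 y²≈x = begin
    x ^ n                       ≈⟨ absorb n 0<n ⟨
    x ^ n * x ^ n               ≈⟨ *-congˡ (*-identityʳ _) ⟨
    (x ^ n) ^ 2                 ≈⟨ ^-assocʳ x n 2 ⟩
    x ^ (n ℕ.* 2)               ≈⟨ x^2n≈1 ⟩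
    1#                          ∎
    where
    x*x^n≈x : x * x ^ n ≈ x
    x*x^n≈x = begin
      x * x ^ n                  ≈⟨ *-cong y²≈x (^-congˡ n y²≈x) ⟨
      y ^ 2 * (y ^ 2) ^ n        ≈⟨ *-congˡ (^-assocʳ y 2 n) ⟩
      y ^ 2 * y ^ (2 ℕ.* n)      ≡⟨ ≡.cong (λ m → y ^ 2 * y ^ m) (ℕP.*-comm 2 n) ⟩
      y ^ 2 * y ^ (n ℕ.* 2)      ≈⟨ solve 2 (λ y z → y :^ 2 :* z := y :* (y :* z)) refl y (y ^ (n ℕ.* 2)) ⟩
      y * y ^ p                  ≈⟨ *-congˡ (x^p y) ⟩
      y * y                      ≈⟨ *-congˡ (*-identityʳ y) ⟨
      y ^ 2                      ≈⟨ y²≈x ⟩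
      x                          ∎
    absorb : ∀ m → 0 < m → x ^ m * x ^ n ≈ x ^ m
    absorb (suc m) _ = begin
      (x * x ^ m) * x ^ n        ≈⟨ solve 3 (λ a b c → (a :* b) :* c := (a :* c) :* b) refl x (x ^ m) (x ^ n) ⟩
      (x * x ^ n) * x ^ m        ≈⟨ *-congʳ x*x^n≈x ⟩
      x * x ^ m                  ∎

  powerSum-double-top : powerSum (2 ℕ.* (n ℕ.* 2)) ≈ - 1#
  powerSum-double-top = begin
    powerSum (2 ℕ.* (n ℕ.* 2))        ≡⟨ ≡.cong (λ k → powerSum (n ℕ.* 2 ℕ.+ k)) (ℕP.+-identityʳ (n ℕ.* 2)) ⟩
    powerSum (n ℕ.* 2 ℕ.+ n ℕ.* 2)    ≈⟨ period (n ℕ.* 2) (ℕP.*-monoˡ-< 2 0<n) ⟩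
    powerSum (n ℕ.* 2)                ≈⟨ powerSum-top ⟩
    - 1#                       ∎
    where
    period : ∀ m → 0 < m → powerSum (m ℕ.+ n ℕ.* 2) ≈ powerSum m
    period (suc m) _ = powerSum-period m

  -- The hypothesis encodes that x is not a square: every y² - x is then prime to p, so Fermat
  -- applies to it. In the expansion the exponents of y are 2i, and only i = n and i = 2n have
  -- nonzero power sums.
  euler-nonsquare : ∀ {x} → (∀ {k} → k < p → (ι k ^ 2 - x) ^ (n ℕ.* 2) ≈ 1#) → x ^ n ≈ - 1#
  euler-nonsquare {x} units = begin
    x ^ n                                         ≈⟨ solve 1 (λ a → a := :- con (+ 1) :- (:- a :+ :- con (+ 1))) refl (x ^ n) ⟩
    - 1# - (- (x ^ n) - 1#)                       ≈⟨ +-congˡ (-‿cong (+-cong (sym fn) (sym ftop))) ⟩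
    - 1# - (f n + f (n ℕ.* 2))                    ≈⟨ +-congˡ (-‿cong (+-congʳ (∑-single f n<2n f≈0))) ⟨
    - 1# - (∑< (n ℕ.* 2) f + f (n ℕ.* 2))         ≈⟨ +-congˡ (-‿cong (∑-snoc (n ℕ.* 2) f)) ⟨
    - 1# - ∑< p f                                 ≈⟨ +-congˡ (-‿cong (∑ₚ-binomial (λ _ → 1#) (_^ 2) (λ _ → - x) (n ℕ.* 2))) ⟨
    - 1# - ∑ₚ (λ y → 1# * (y ^ 2 - x) ^ (n ℕ.* 2)) ≈⟨ +-congˡ (-‿cong (∑ₚ-∑ _)) ⟩
    - 1# - ∑< p (λ k → 1# * (ι k ^ 2 - x) ^ (n ℕ.* 2))
      ≈⟨ +-congˡ (-‿cong (∑-ones p (λ k<p → trans (*-identityˡ _) (units k<p)))) ⟩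
    - 1# - ι p                                    ≈⟨ +-congˡ (-‿cong ι-p) ⟩
    - 1# - 0#                                     ≈⟨ trans (+-congˡ -0#≈0#) (+-identityʳ _) ⟩
    - 1#                                          ∎
    where
    f : ℕ → Carrier
    f i = ι ((n ℕ.* 2) C i) * ∑ₚ (λ y → 1# * ((y ^ 2) ^ i * (- x) ^ (n ℕ.* 2 ∸ i)))
    f≈ : ∀ i → f i ≈ ι ((n ℕ.* 2) C i) * ((- x) ^ (n ℕ.* 2 ∸ i) * powerSum (2 ℕ.* i))
    f≈ i = *-congˡ (trans (∑ₚ-cong (λ y → trans (*-identityˡ _) (trans (*-comm _ _) (*-congˡ (^-assocʳ y 2 i))))) (∑ₚ-* _ _))
    n<2n : n < n ℕ.* 2
    n<2n = ℕP.m<m*n n 2 {{ℕ.>-nonZero 0<n}} (s<s z<s)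
    f≈0 : ∀ {i} → i < n ℕ.* 2 → i ≢ n → f i ≈ 0#
    f≈0 {i} i<2n i≢n = begin
      f i                                                                  ≈⟨ f≈ i ⟩
      ι ((n ℕ.* 2) C i) * ((- x) ^ (n ℕ.* 2 ∸ i) * powerSum (2 ℕ.* i))            ≈⟨ *-congˡ (*-congˡ (powerSum-zero
        (≡.subst (2 ℕ.* i <_) (≡.cong (n ℕ.* 2 ℕ.+_) (ℕP.+-identityʳ (n ℕ.* 2))) (ℕP.*-monoʳ-< 2 i<2n))
        (λ 2i≡2n → i≢n (ℕP.*-cancelˡ-≡ i n 2 (≡.trans 2i≡2n (ℕP.*-comm n 2)))))) ⟩
      ι ((n ℕ.* 2) C i) * ((- x) ^ (n ℕ.* 2 ∸ i) * 0#)                     ≈⟨ trans (*-congˡ (zeroʳ _)) (zeroʳ _) ⟩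
      0#                                                                   ∎
    ftop : f (n ℕ.* 2) ≈ - 1#
    ftop = begin
      f (n ℕ.* 2)                                                ≈⟨ f≈ (n ℕ.* 2) ⟩
      ι ((n ℕ.* 2) C (n ℕ.* 2)) * ((- x) ^ (n ℕ.* 2 ∸ n ℕ.* 2) * powerSum (2 ℕ.* (n ℕ.* 2)))
        ≈⟨ *-cong (reflexive (≡.cong ι (nCn≡1 (n ℕ.* 2)))) (*-cong (reflexive (≡.cong ((- x) ^_) (ℕP.n∸n≡0 (n ℕ.* 2)))) powerSum-double-top) ⟩
      1# * (1# * - 1#)                                           ≈⟨ trans (*-identityˡ _) (*-identityˡ _) ⟩
      - 1#                                                       ∎
    fn : f n ≈ - (x ^ n)
    fn = begin
      f n                                                        ≈⟨ f≈ n ⟩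
      ι ((n ℕ.* 2) C n) * ((- x) ^ (n ℕ.* 2 ∸ n) * powerSum (2 ℕ.* n))
        -- Upper negation with a = 0 gives C(2n,n) = (-1)ⁿ, the sign that later turns (-x)ⁿ into xⁿ.
        ≈⟨ *-cong (trans (C-negate 0 n (ℕP.+-identityʳ (n ℕ.* 2)) n<p) (trans (*-congˡ (reflexive (≡.cong ι (nCn≡1 n)))) (*-identityʳ _)))
            (*-cong (reflexive (≡.cong ((- x) ^_) (≡.trans (≡.cong (_∸ n) (≡.trans (ℕP.*-comm n 2) (≡.cong (n ℕ.+_) (ℕP.+-identityʳ n)))) (ℕP.m+n∸n≡m n n))))
              (trans (reflexive (≡.cong powerSum (ℕP.*-comm 2 n))) powerSum-top)) ⟩
      (- 1#) ^ n * ((- x) ^ n * - 1#)                            ≈⟨ solve 2 (λ a b → a :* (b :* :- con (+ 1)) := :- (a :* b)) refl _ _ ⟩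
      - ((- 1#) ^ n * (- x) ^ n)                                 ≈⟨ -‿cong (^-distrib-* (- 1#) (- x) n) ⟨
      - ((- 1# * - x) ^ n)                                       ≈⟨ -‿cong (^-congˡ n (solve 1 (λ x → :- con (+ 1) :* :- x := x) refl x)) ⟩
      - (x ^ n)                                                  ∎

  ⟦⟧-square-minus : ∀ i j → ⟦ i ℤ.^ 2 ℤ.- j ⟧ ≈ ⟦ i ⟧ ^ 2 - ⟦ j ⟧
  ⟦⟧-square-minus i j = begin
    ⟦ i ℤ.^ 2 ℤ.- j ⟧                     ≈⟨ ⟦⟧-+ (i ℤ.^ 2) (ℤ.- j) ⟩
    ⟦ i ℤ.* (i ℤ.* + 1) ⟧ + ⟦ ℤ.- j ⟧     ≈⟨ +-cong (trans (⟦⟧-* i (i ℤ.* + 1)) (*-congˡ (⟦⟧-* i (+ 1)))) (⟦⟧-neg j) ⟩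
    ⟦ i ⟧ ^ 2 - ⟦ j ⟧                     ∎

  legendreℤ-≈ : ∀ m → ⟦ legendreℤ m p ⟧ ≈ ⟦ m ⟧ ^ n
  legendreℤ-≈ m with + p ℤ∣.∣? m | isSquareMod? p m
  ... | yes p∣m | _ = sym (trans (^-congˡ n (⟦⟧-∣ p∣m)) (0^ 0<n))
  ... | no  p∤m | yes (y , p∣y²-m) = sym (euler-square (ι (toℕ y)) (fermat-ℤ p∤m) (begin
    ι (toℕ y) ^ 2                          ≈⟨ solve 2 (λ a b → a := (a :- b) :+ b) refl _ _ ⟩
    (ι (toℕ y) ^ 2 - ⟦ m ⟧) + ⟦ m ⟧        ≈⟨ +-congʳ (⟦⟧-square-minus (+ toℕ y) m) ⟨
    ⟦ (+ toℕ y) ℤ.^ 2 ℤ.- m ⟧ + ⟦ m ⟧      ≈⟨ +-congʳ (⟦⟧-∣ p∣y²-m) ⟩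
    0# + ⟦ m ⟧                             ≈⟨ +-identityˡ _ ⟩
    ⟦ m ⟧                                  ∎))
  ... | no  _ | no nonsquare = sym (euler-nonsquare (λ {k} k<p → trans
    (^-congˡ (n ℕ.* 2) (sym (⟦⟧-square-minus (+ k) m)))
    (fermat-ℤ (λ p∣ → nonsquare (fromℕ< k<p , ≡.subst (λ j → + p ℤ∣.∣ (+ j) ℤ.^ 2 ℤ.- m) (≡.sym (toℕ-fromℕ< k<p)) p∣)))))

  -- Two evaluations of the sum of n-th powers of the cubic.

  cubic : Carrier → Carrier → Carrier
  cubic t x = x ^ 3 - ι 3 * (t ^ 2 + ι 3) * x + ι 2 * t * (t ^ 2 - ι 9)

  cubicSum : Carrier → Carrier
  cubicSum t = ∑ₚ (λ x → cubic t x ^ n)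

  cubicSum-shift : ∀ t c → cubicSum t ≈ ∑ₚ (λ y → cubic t (y + c) ^ n)
  cubicSum-shift t c = sym (∑ₚ-shift (λ x≈y → ^-congˡ n (+-congʳ (+-cong (^-congˡ 3 x≈y) (-‿cong (*-congˡ x≈y))))) c)

  -- Only (y² - 9)ⁿ is expanded. Its term y^(2(n-k)) needs the complementary exponent 2k from (y +
  -- 3t)ⁿ to reach 2n, and this is the source of C(n,2k).
  cubicSum-even : ∀ t → cubicSum t ≈
    - (ι 3 ^ n * ∑< (suc n) (λ k → (- 1#) ^ k * (ι (n C k) * ι (n C (2 ℕ.* k))) * t ^ (n ∸ 2 ℕ.* k)))
  cubicSum-even t = begin
    cubicSum t
      ≈⟨ cubicSum-shift t t ⟩
    ∑ₚ (λ y → cubic t (y + t) ^ n)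
      ≈⟨ ∑ₚ-cong (λ y → trans
          (^-congˡ n (solve 2 (λ t y → (y :+ t) :^ 3 :- con (+ 3) :* (t :^ 2 :+ con (+ 3)) :* (y :+ t) :+ con (+ 2) :* t :* (t :^ 2 :- con (+ 9))
            := (y :+ con (+ 3) :* t) :* (:- con (+ 9) :+ y :^ 2)) refl t y))
          (^-distrib-* (y + ι 3 * t) (- ι 9 + y ^ 2) n)) ⟩
    ∑ₚ (λ y → (y + ι 3 * t) ^ n * (- ι 9 + y ^ 2) ^ n)
      ≈⟨ ∑ₚ-binomial (λ y → (y + ι 3 * t) ^ n) (λ _ → - ι 9) (_^ 2) n ⟩
    ∑< (suc n) (λ k → ι (n C k) * ∑ₚ (λ y → (y + ι 3 * t) ^ n * ((- ι 9) ^ k * (y ^ 2) ^ (n ∸ k))))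
      ≈⟨ ∑-cong (suc n) (λ k<1+n → term (ℕ.s≤s⁻¹ k<1+n)) ⟩
    ∑< (suc n) (λ k → - (ι 3 ^ n) * A k)
      ≈⟨ *-∑ (suc n) (- (ι 3 ^ n)) A ⟨
    - (ι 3 ^ n) * ∑< (suc n) A
      ≈⟨ -‿distribˡ-* _ _ ⟨
    - (ι 3 ^ n * ∑< (suc n) A) ∎
    where
    A : ℕ → Carrier
    A k = (- 1#) ^ k * (ι (n C k) * ι (n C (2 ℕ.* k))) * t ^ (n ∸ 2 ℕ.* k)
    -- Collecting 3^(2k) · 3^(n-2k) into 3ⁿ is valid only for 2k ≤ n. For larger k the difference is
    -- truncated, but both sides carry the zero factor n C 2k.
    by-parity : ∀ k → ι (n C (2 ℕ.* k)) * ((- ι 9) ^ k * (ι 3 * t) ^ (n ∸ 2 ℕ.* k))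
              ≈ ι (n C (2 ℕ.* k)) * (ι 3 ^ n * ((- 1#) ^ k * t ^ (n ∸ 2 ℕ.* k)))
    by-parity k with ℕP.<-≤-connex n (2 ℕ.* k)
    ... | inj₁ n<2k = trans (vanish _) (sym (vanish _))
      where
      vanish : ∀ x → ι (n C (2 ℕ.* k)) * x ≈ 0#
      vanish x = trans (*-congʳ (reflexive (≡.cong ι (k>n⇒nCk≡0 n<2k)))) (zeroˡ x)
    ... | inj₂ 2k≤n = *-congˡ (begin
      (- ι 9) ^ k * (ι 3 * t) ^ m
        ≈⟨ *-cong (trans (^-congˡ k (solve 0 (:- con (+ 9) := :- con (+ 1) :* con (+ 3) :^ 2) refl)) (^-distrib-* (- 1#) (ι 3 ^ 2) k))
             (^-distrib-* (ι 3) t m) ⟩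
      ((- 1#) ^ k * (ι 3 ^ 2) ^ k) * (ι 3 ^ m * t ^ m)
        ≈⟨ *-congʳ (*-congˡ (^-assocʳ (ι 3) 2 k)) ⟩
      ((- 1#) ^ k * ι 3 ^ (2 ℕ.* k)) * (ι 3 ^ m * t ^ m)
        ≈⟨ solve 4 (λ a b c d → (a :* b) :* (c :* d) := (b :* c) :* (a :* d)) refl _ _ _ _ ⟩
      (ι 3 ^ (2 ℕ.* k) * ι 3 ^ m) * ((- 1#) ^ k * t ^ m)
        ≈⟨ *-congʳ (trans (sym (^-homo-* (ι 3) (2 ℕ.* k) m)) (reflexive (≡.cong (ι 3 ^_) (ℕP.m+[n∸m]≡n 2k≤n)))) ⟩
      ι 3 ^ n * ((- 1#) ^ k * t ^ m) ∎)
      where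
      m : ℕ
      m = n ∸ 2 ℕ.* k
    term : ∀ {k} → k ≤ n → ι (n C k) * ∑ₚ (λ y → (y + ι 3 * t) ^ n * ((- ι 9) ^ k * (y ^ 2) ^ (n ∸ k))) ≈ - (ι 3 ^ n) * A k
    term {k} k≤n = begin
      ι (n C k) * ∑ₚ (λ y → (y + ι 3 * t) ^ n * ((- ι 9) ^ k * (y ^ 2) ^ (n ∸ k)))
        ≈⟨ *-congˡ (trans (∑ₚ-cong (λ y → trans
            (solve 3 (λ a b c → a :* (b :* c) := b :* (c :* a)) refl _ _ _)
            (*-congˡ (*-congʳ (^-assocʳ y 2 (n ∸ k)))))) (∑ₚ-* _ _)) ⟩
      ι (n C k) * ((- ι 9) ^ k * ∑ₚ (λ y → y ^ (2 ℕ.* (n ∸ k)) * (y + ι 3 * t) ^ n))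
        ≈⟨ *-congˡ (*-congˡ (∑ₚ-^-*-[+]^ (2 ℕ.* (n ∸ k)) (2 ℕ.* k) (ι 3 * t) exponents)) ⟩
      ι (n C k) * ((- ι 9) ^ k * - (ι (n C (2 ℕ.* k)) * (ι 3 * t) ^ (n ∸ 2 ℕ.* k)))
        ≈⟨ solve 4 (λ a b c d → a :* (b :* :- (c :* d)) := :- (a :* (c :* (b :* d)))) refl _ _ _ _ ⟩
      - (ι (n C k) * (ι (n C (2 ℕ.* k)) * ((- ι 9) ^ k * (ι 3 * t) ^ (n ∸ 2 ℕ.* k))))
        ≈⟨ -‿cong (*-congˡ (by-parity k)) ⟩
      - (ι (n C k) * (ι (n C (2 ℕ.* k)) * (ι 3 ^ n * ((- 1#) ^ k * t ^ (n ∸ 2 ℕ.* k)))))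
        ≈⟨ solve 5 (λ a b c d e → :- (a :* (b :* (c :* (d :* e)))) := :- c :* (d :* (a :* b) :* e)) refl _ _ _ _ _ ⟩
      - (ι 3 ^ n) * A k ∎
      where
      exponents : 2 ℕ.* (n ∸ k) ℕ.+ 2 ℕ.* k ≡ n ℕ.* 2
      exponents = ≡.trans (≡.sym (ℕP.*-distribˡ-+ 2 (n ∸ k) k)) (≡.trans (≡.cong (2 ℕ.*_) (ℕP.m∸n+n≡m k≤n)) (ℕP.*-comm 2 n))

  -- The variable u stands for (1 - t)/2, given by an equation to avoid division. Expanding (y - 6)ⁿ
  -- supplies C(n,k); as y^(n+k) is then present, (y + 3(t-1))ⁿ must supply exponent n - k, hence a
  -- second C(n,k) and (3(t-1))^k = (-6u)^k.
  cubicSum-squares : ∀ t u → - ι 6 * u ≈ ι 3 * (t - 1#) → cubicSum t ≈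
    - ((- ι 6) ^ n * ∑< (suc n) (λ k → ι (n C k) * ι (n C k) * u ^ k))
  cubicSum-squares t u -6u≈c = begin
    cubicSum t
      ≈⟨ cubicSum-shift t (t - ι 3) ⟩
    ∑ₚ (λ y → cubic t (y + (t - ι 3)) ^ n)
      ≈⟨ ∑ₚ-cong (λ y → trans
          (^-congˡ n (solve 2 (λ t y → (y :+ (t :- con (+ 3))) :^ 3 :- con (+ 3) :* (t :^ 2 :+ con (+ 3)) :* (y :+ (t :- con (+ 3))) :+ con (+ 2) :* t :* (t :^ 2 :- con (+ 9))
            := (y :* (y :+ con (+ 3) :* (t :- con (+ 1)))) :* (y :+ :- con (+ 6))) refl t y))
          (trans (^-distrib-* (y * (y + c)) (y + - ι 6) n) (*-congʳ (^-distrib-* y (y + c) n)))) ⟩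
    ∑ₚ (λ y → (y ^ n * (y + c) ^ n) * (y + - ι 6) ^ n)
      ≈⟨ ∑ₚ-binomial (λ y → y ^ n * (y + c) ^ n) (λ y → y) (λ _ → - ι 6) n ⟩
    ∑< (suc n) (λ k → ι (n C k) * ∑ₚ (λ y → (y ^ n * (y + c) ^ n) * (y ^ k * (- ι 6) ^ (n ∸ k))))
      ≈⟨ ∑-cong (suc n) (λ k<1+n → term (ℕ.s≤s⁻¹ k<1+n)) ⟩
    ∑< (suc n) (λ k → - ((- ι 6) ^ n) * B k)
      ≈⟨ *-∑ (suc n) (- ((- ι 6) ^ n)) B ⟨
    - ((- ι 6) ^ n) * ∑< (suc n) B
      ≈⟨ -‿distribˡ-* _ _ ⟨
    - ((- ι 6) ^ n * ∑< (suc n) B) ∎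
    where
    c : Carrier
    c = ι 3 * (t - 1#)
    B : ℕ → Carrier
    B k = ι (n C k) * ι (n C k) * u ^ k
    term : ∀ {k} → k ≤ n → ι (n C k) * ∑ₚ (λ y → (y ^ n * (y + c) ^ n) * (y ^ k * (- ι 6) ^ (n ∸ k))) ≈ - ((- ι 6) ^ n) * B k
    term {k} k≤n = begin
      ι (n C k) * ∑ₚ (λ y → (y ^ n * (y + c) ^ n) * (y ^ k * (- ι 6) ^ (n ∸ k)))
        ≈⟨ *-congˡ (trans (∑ₚ-cong (λ y → trans
            (solve 4 (λ a b c d → (a :* b) :* (c :* d) := d :* ((a :* c) :* b)) refl _ _ _ _)
            (*-congˡ (*-congʳ (sym (^-homo-* y n k)))))) (∑ₚ-* _ _)) ⟩
      ι (n C k) * ((- ι 6) ^ (n ∸ k) * ∑ₚ (λ y → y ^ (n ℕ.+ k) * (y + c) ^ n))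
        ≈⟨ *-congˡ (*-congˡ (∑ₚ-^-*-[+]^ (n ℕ.+ k) (n ∸ k) c exponents)) ⟩
      ι (n C k) * ((- ι 6) ^ (n ∸ k) * - (ι (n C (n ∸ k)) * c ^ (n ∸ (n ∸ k))))
        ≡⟨ ≡.cong₂ (λ i j → ι (n C k) * ((- ι 6) ^ (n ∸ k) * - (ι i * c ^ j))) (≡.sym (nCk≡nC[n∸k] k≤n)) (ℕP.m∸[m∸n]≡n k≤n) ⟩
      ι (n C k) * ((- ι 6) ^ (n ∸ k) * - (ι (n C k) * c ^ k))
        ≈⟨ *-congˡ (*-congˡ (-‿cong (*-congˡ (trans (^-congˡ k (sym -6u≈c)) (^-distrib-* (- ι 6) u k))))) ⟩
      ι (n C k) * ((- ι 6) ^ (n ∸ k) * - (ι (n C k) * ((- ι 6) ^ k * u ^ k)))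
        ≈⟨ solve 4 (λ a b c d → a :* (b :* :- (a :* (c :* d))) := :- (b :* c) :* (a :* a :* d)) refl _ _ _ _ ⟩
      - ((- ι 6) ^ (n ∸ k) * (- ι 6) ^ k) * B k
        ≈⟨ *-congʳ (-‿cong (trans (sym (^-homo-* (- ι 6) (n ∸ k) k)) (reflexive (≡.cong ((- ι 6) ^_) (ℕP.m∸n+n≡m k≤n))))) ⟩
      - ((- ι 6) ^ n) * B k ∎
      where
      exponents : n ℕ.+ k ℕ.+ (n ∸ k) ≡ n ℕ.* 2
      exponents = ≡.trans (ℕP.+-assoc n k (n ∸ k)) (≡.trans (≡.cong (n ℕ.+_) (≡.trans (ℕP.m+[n∸m]≡n k≤n) (≡.sym (ℕP.+-identityʳ n)))) (ℕP.*-comm 2 n))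

  -- The binomial sum and the Legendre sum as multiples of the cubic sum.

  p∤6 : 3 < p → ¬ p ℕ∣.∣ 6
  p∤6 3<p p∣6 with euclidsLemma 2 3 p-prime p∣6
  ... | inj₁ p∣2 = ℕ∣.>⇒∤ (ℕP.<-trans (s<s (s<s z<s)) 3<p) p∣2
  ... | inj₂ p∣3 = ℕ∣.>⇒∤ 3<p p∣3

  -- Makes (-6)ⁿ its own inverse, so that it can be moved across the evaluations of the cubic sum.
  [-6]^n-squared : 3 < p → (- ι 6) ^ n * (- ι 6) ^ n ≈ 1#
  [-6]^n-squared 3<p = begin
    (- ι 6) ^ n * (- ι 6) ^ n   ≈⟨ *-congˡ (*-identityʳ _) ⟨
    ((- ι 6) ^ n) ^ 2           ≈⟨ ^-assocʳ (- ι 6) n 2 ⟩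
    (- ι 6) ^ (n ℕ.* 2)         ≈⟨ fermat-ℤ { -[1+ 5 ]} (p∤6 3<p ∘ ℤ∣.∣⇒∣ᵤ) ⟩
    1#                          ∎

  -- The 32 is 2 · 16: the squares of the central coefficients contribute ((-4)^k)² = 16^k, which
  -- leaves (1 - t)/2. The element e plays the role of 1/32.
  binomialSum-≈ : 3 < p → ∀ t e → ι 32 * e ≈ 1# →
    ∑< (suc n) (λ k → ι (((2 ℕ.* k) C k) ℕ.^ 2) * ((1# - t) * e) ^ k) ≈ - ((- ι 6) ^ n * cubicSum t)
  binomialSum-≈ 3<p t e 32*e≈1 = begin
    ∑< (suc n) (λ k → ι (((2 ℕ.* k) C k) ℕ.^ 2) * ((1# - t) * e) ^ k)
      ≈⟨ ∑-cong (suc n) (λ k<1+n → term (ℕ.s≤s⁻¹ k<1+n)) ⟩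
    B
      ≈⟨ trans (*-congʳ ([-6]^n-squared 3<p)) (*-identityˡ B) ⟨
    (- ι 6) ^ n * (- ι 6) ^ n * B
      ≈⟨ solve 2 (λ a b → a :* a :* b := :- (a :* :- (a :* b))) refl _ _ ⟩
    - ((- ι 6) ^ n * - ((- ι 6) ^ n * B))
      ≈⟨ -‿cong (*-congˡ (cubicSum-squares t u -6u≈3[t-1])) ⟨
    - ((- ι 6) ^ n * cubicSum t) ∎
    where
    w u B : Carrier
    w = (1# - t) * e
    u = ι 16 * w
    B = ∑< (suc n) (λ k → ι (n C k) * ι (n C k) * u ^ k)
    -6u≈3[t-1] : - ι 6 * u ≈ ι 3 * (t - 1#)
    -6u≈3[t-1] = begin
      - ι 6 * u                           ≈⟨ solve 2 (λ t e → :- con (+ 6) :* (con (+ 16) :* ((con (+ 1) :- t) :* e)) := con (+ 3) :* (t :- con (+ 1)) :* (con (+ 32) :* e)) refl t e ⟩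
      ι 3 * (t - 1#) * (ι 32 * e)         ≈⟨ trans (*-congˡ 32*e≈1) (*-identityʳ _) ⟩
      ι 3 * (t - 1#)                      ∎
    term : ∀ {k} → k ≤ n → ι (((2 ℕ.* k) C k) ℕ.^ 2) * w ^ k ≈ ι (n C k) * ι (n C k) * u ^ k
    term {k} k≤n = begin
      ι (((2 ℕ.* k) C k) ℕ.^ 2) * w ^ k
        ≡⟨ ≡.cong (λ m → ι (((2 ℕ.* k) C k) ℕ.* m) * w ^ k) (ℕP.*-identityʳ ((2 ℕ.* k) C k)) ⟩
      ι (((2 ℕ.* k) C k) ℕ.* ((2 ℕ.* k) C k)) * w ^ k
        ≈⟨ *-congʳ (trans (ι-* ((2 ℕ.* k) C k) ((2 ℕ.* k) C k)) (*-cong (C-central-≈ k k≤n) (C-central-≈ k k≤n))) ⟩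
      ((- ι 4) ^ k * ι (n C k)) * ((- ι 4) ^ k * ι (n C k)) * w ^ k
        ≈⟨ solve 3 (λ a b c → (a :* b) :* (a :* b) :* c := b :* b :* ((a :* a) :* c)) refl _ _ _ ⟩
      ι (n C k) * ι (n C k) * (((- ι 4) ^ k * (- ι 4) ^ k) * w ^ k)
        ≈⟨ *-congˡ (begin
          ((- ι 4) ^ k * (- ι 4) ^ k) * w ^ k     ≈⟨ *-congʳ (^-distrib-* (- ι 4) (- ι 4) k) ⟨
          (- ι 4 * - ι 4) ^ k * w ^ k             ≈⟨ ^-distrib-* (- ι 4 * - ι 4) w k ⟨
          (- ι 4 * - ι 4 * w) ^ k                 ≈⟨ ^-congˡ k (solve 1 (λ w → :- con (+ 4) :* :- con (+ 4) :* w := con (+ 16) :* w) refl w) ⟩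
          u ^ k                                   ∎) ⟩
      ι (n C k) * ι (n C k) * u ^ k ∎

  -- Here g is the inverse of 2ⁿ. After inserting the square of (-6)ⁿ, one copy is split as (-1)ⁿ 2ⁿ
  -- 3ⁿ: its sign cancels the one from the binomial coefficients, 2ⁿ cancels g, and 3ⁿ is the factor
  -- in `cubicSum-even`.
  legendreSum-≈ : 3 < p → ∀ t g → ι 2 ^ n * g ≈ 1# →
    g * ∑< (suc (n ℕ./ 2)) (λ k → ((- 1#) ^ k * ι ((n C k) ℕ.* ((2 ℕ.* n ∸ 2 ℕ.* k) C n))) * t ^ (n ∸ 2 ℕ.* k))
      ≈ - ((- ι 6) ^ n * cubicSum t)
  legendreSum-≈ 3<p t g 2ⁿg≈1 = begin
    g * ∑< (suc (n ℕ./ 2)) L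
      ≈⟨ *-congˡ (∑-cong (suc (n ℕ./ 2)) (λ k≤n/2 → term (ℕP.≤-trans (ℕ.s≤s⁻¹ k≤n/2) (ℕDM.m/n≤m n 2)))) ⟩
    g * ∑< (suc (n ℕ./ 2)) (λ k → (- 1#) ^ n * A k)
      -- For k > n/2 the factor n C 2k is zero, so the sum can be continued up to n, the range used
      -- in `cubicSum-even`.
      ≈⟨ *-congˡ (∑-extend (suc (n ℕ./ 2)) (n ∸ n ℕ./ 2) (λ k → (- 1#) ^ n * A k) beyond) ⟨
    g * ∑< (suc (n ℕ./ 2) ℕ.+ (n ∸ n ℕ./ 2)) (λ k → (- 1#) ^ n * A k)
      ≡⟨ ≡.cong (λ N → g * ∑< (suc N) (λ k → (- 1#) ^ n * A k)) (ℕP.m+[n∸m]≡n (ℕDM.m/n≤m n 2)) ⟩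
    g * ∑< (suc n) (λ k → (- 1#) ^ n * A k)
      ≈⟨ *-congˡ (*-∑ (suc n) ((- 1#) ^ n) A) ⟨
    g * ((- 1#) ^ n * ΣA)
      ≈⟨ trans (*-congʳ ([-6]^n-squared 3<p)) (*-identityˡ _) ⟨
    (- ι 6) ^ n * (- ι 6) ^ n * (g * ((- 1#) ^ n * ΣA))
      ≈⟨ *-congʳ (*-congˡ [-6]^n) ⟩
    (- ι 6) ^ n * ((- 1#) ^ n * (ι 2 ^ n * ι 3 ^ n)) * (g * ((- 1#) ^ n * ΣA))
      ≈⟨ solve 6 (λ a b c d e f → a :* (b :* (c :* d)) :* (e :* (b :* f)) := (b :* b) :* ((c :* e) :* (a :* (d :* f)))) refl _ _ _ _ _ _ ⟩
    ((- 1#) ^ n * (- 1#) ^ n) * ((ι 2 ^ n * g) * ((- ι 6) ^ n * (ι 3 ^ n * ΣA)))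
      ≈⟨ *-cong [-1]^n-squared (trans (*-congʳ 2ⁿg≈1) (*-identityˡ _)) ⟩
    1# * ((- ι 6) ^ n * (ι 3 ^ n * ΣA))
      ≈⟨ solve 2 (λ a b → con (+ 1) :* (a :* b) := :- (a :* :- b)) refl _ _ ⟩
    - ((- ι 6) ^ n * - (ι 3 ^ n * ΣA))
      ≈⟨ -‿cong (*-congˡ (cubicSum-even t)) ⟨
    - ((- ι 6) ^ n * cubicSum t) ∎
    where
    A L : ℕ → Carrier
    A k = (- 1#) ^ k * (ι (n C k) * ι (n C (2 ℕ.* k))) * t ^ (n ∸ 2 ℕ.* k)
    L k = ((- 1#) ^ k * ι ((n C k) ℕ.* ((2 ℕ.* n ∸ 2 ℕ.* k) C n))) * t ^ (n ∸ 2 ℕ.* k)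
    ΣA : Carrier
    ΣA = ∑< (suc n) A
    term : ∀ {k} → k ≤ n → L k ≈ (- 1#) ^ n * A k
    term {k} k≤n = begin
      L k
        ≈⟨ *-congʳ (*-congˡ (trans (ι-* (n C k) ((2 ℕ.* n ∸ 2 ℕ.* k) C n)) (*-congˡ (C-[2n∸2k]-n k k≤n)))) ⟩
      ((- 1#) ^ k * (ι (n C k) * ((- 1#) ^ n * ι (n C (2 ℕ.* k))))) * t ^ (n ∸ 2 ℕ.* k)
        ≈⟨ solve 5 (λ a b c d e → (a :* (b :* (c :* d))) :* e := c :* (a :* (b :* d) :* e)) refl _ _ _ _ _ ⟩
      (- 1#) ^ n * A k ∎
    beyond : ∀ {k} → suc (n ℕ./ 2) ≤ k → (- 1#) ^ n * A k ≈ 0#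
    beyond {k} n/2<k = trans (*-congˡ (trans (*-congʳ (*-congˡ (*-congˡ (reflexive (≡.cong ι (k>n⇒nCk≡0 n<2k))))))
      (solve 3 (λ a b c → a :* (b :* con (+ 0)) :* c := con (+ 0)) refl ((- 1#) ^ k) (ι (n C k)) (t ^ (n ∸ 2 ℕ.* k))))) (zeroʳ _)
      where
      n<2k : n < 2 ℕ.* k
      n<2k = ≡.subst (n <_) (ℕP.*-comm k 2) (≡.subst (_< k ℕ.* 2) (≡.sym (ℕDM.m≡m%n+[m/n]*n n 2))
        (ℕP.<-≤-trans (ℕP.+-monoˡ-< (n ℕ./ 2 ℕ.* 2) (ℕDM.m%n<n n 2)) (ℕP.*-monoˡ-≤ 2 n/2<k)))
    [-1]^n-squared : (- 1#) ^ n * (- 1#) ^ n ≈ 1#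
    [-1]^n-squared = trans (sym (^-distrib-* (- 1#) (- 1#) n)) (trans (^-congˡ n (solve 0 (:- con (+ 1) :* :- con (+ 1) := con (+ 1)) refl)) (1^ n))
    [-6]^n : (- ι 6) ^ n ≈ (- 1#) ^ n * (ι 2 ^ n * ι 3 ^ n)
    [-6]^n = trans (^-congˡ n (solve 0 (:- con (+ 6) := :- con (+ 1) :* (con (+ 2) :* con (+ 3))) refl))
      (trans (^-distrib-* (- 1#) (ι 2 * ι 3) n) (*-congˡ (^-distrib-* (ι 2) (ι 3) n)))

open import Data.Integer.Solver using () renaming (module +-*-Solver to ℤS)
import Data.Integer.DivMod as ℤDM
open import Data.Rational.Base using (ℚ; _+_; _-_; _*_; -_; _/_; 0ℚ; 1ℚ; ↥_; ↧_; ↧ₙ_; toℚᵘ)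
import Data.Rational.Properties as ℚP
open import Data.Rational.Solver using () renaming (module +-*-Solver to ℚS)
import Algebra.Properties.CommutativeMonoid.Sum ℚP.+-0-commutativeMonoid as ℚΣ
import Data.Rational.Unnormalised.Base as ℚᵘ
import Data.Rational.Unnormalised.Properties as ℚᵘP
open import Defs
open import Level using (0ℓ)

-- Integers and fractions inside ℚ.

[q*m]/m : ∀ q m .{{_ : NonZero m}} → (q ℤ.* + m) / m ≡ ℤ→ℚ q
[q*m]/m q (suc m-1) = ℚP.fromℚᵘ-cong {ℚᵘ.mkℚᵘ (q ℤ.* + suc m-1) m-1} {ℚᵘ.mkℚᵘ q 0}
  (ℚᵘ.*≡* (ℤP.*-identityʳ (q ℤ.* + suc m-1)))

toℚᵘ-ℤ→ℚ : ∀ i → toℚᵘ (ℤ→ℚ i) ℚᵘ.≃ ℚᵘ.mkℚᵘ i 0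
toℚᵘ-ℤ→ℚ i = ℚP.toℚᵘ-fromℚᵘ (ℚᵘ.mkℚᵘ i 0)

ℤ→ℚ-+ : ∀ i j → ℤ→ℚ (i ℤ.+ j) ≡ ℤ→ℚ i + ℤ→ℚ j
ℤ→ℚ-+ i j = ℚP.toℚᵘ-injective (begin
  toℚᵘ (ℤ→ℚ (i ℤ.+ j))                  ≈⟨ toℚᵘ-ℤ→ℚ (i ℤ.+ j) ⟩
  ℚᵘ.mkℚᵘ (i ℤ.+ j) 0                   ≈⟨ ℚᵘ.*≡* (solve 2 (λ i j → (i :+ j) :* con (+ 1) := (i :* con (+ 1) :+ j :* con (+ 1)) :* con (+ 1)) ≡.refl i j) ⟩
  ℚᵘ.mkℚᵘ i 0 ℚᵘ.+ ℚᵘ.mkℚᵘ j 0          ≈⟨ ℚᵘP.+-cong (toℚᵘ-ℤ→ℚ i) (toℚᵘ-ℤ→ℚ j) ⟨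
  toℚᵘ (ℤ→ℚ i) ℚᵘ.+ toℚᵘ (ℤ→ℚ j)        ≈⟨ ℚP.toℚᵘ-homo-+ (ℤ→ℚ i) (ℤ→ℚ j) ⟨
  toℚᵘ (ℤ→ℚ i + ℤ→ℚ j)                  ∎)
  where
  open import Relation.Binary.Reasoning.Setoid ℚᵘP.≃-setoid
  open ℤS using (solve; con; _:+_; _:*_; _:=_)

ℤ→ℚ-* : ∀ i j → ℤ→ℚ (i ℤ.* j) ≡ ℤ→ℚ i * ℤ→ℚ j
ℤ→ℚ-* i j = ℚP.toℚᵘ-injective (begin
  toℚᵘ (ℤ→ℚ (i ℤ.* j))                  ≈⟨ toℚᵘ-ℤ→ℚ (i ℤ.* j) ⟩
  ℚᵘ.mkℚᵘ (i ℤ.* j) 0                   ≈⟨ ℚᵘ.*≡* ≡.refl ⟩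
  ℚᵘ.mkℚᵘ i 0 ℚᵘ.* ℚᵘ.mkℚᵘ j 0          ≈⟨ ℚᵘP.*-cong (toℚᵘ-ℤ→ℚ i) (toℚᵘ-ℤ→ℚ j) ⟨
  toℚᵘ (ℤ→ℚ i) ℚᵘ.* toℚᵘ (ℤ→ℚ j)        ≈⟨ ℚP.toℚᵘ-homo-* (ℤ→ℚ i) (ℤ→ℚ j) ⟨
  toℚᵘ (ℤ→ℚ i * ℤ→ℚ j)                  ∎)
  where open import Relation.Binary.Reasoning.Setoid ℚᵘP.≃-setoid

ℤ→ℚ-neg : ∀ i → ℤ→ℚ (ℤ.- i) ≡ - ℤ→ℚ i
ℤ→ℚ-neg i = ℚP.toℚᵘ-injective (begin
  toℚᵘ (ℤ→ℚ (ℤ.- i))                    ≈⟨ toℚᵘ-ℤ→ℚ (ℤ.- i) ⟩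
  ℚᵘ.- ℚᵘ.mkℚᵘ i 0                      ≈⟨ ℚᵘP.-‿cong (toℚᵘ-ℤ→ℚ i) ⟨
  ℚᵘ.- toℚᵘ (ℤ→ℚ i)                     ≈⟨ ℚP.toℚᵘ-homo‿- (ℤ→ℚ i) ⟨
  toℚᵘ (- ℤ→ℚ i)                        ∎)
  where open import Relation.Binary.Reasoning.Setoid ℚᵘP.≃-setoid

/-*-cancel : ∀ i m .{{_ : NonZero m}} → (i / m) * ℤ→ℚ (+ m) ≡ ℤ→ℚ i
/-*-cancel i m@(suc m-1) = ℚP.toℚᵘ-injective (begin
  toℚᵘ ((i / m) * ℤ→ℚ (+ m))            ≈⟨ ℚP.toℚᵘ-homo-* (i / m) (ℤ→ℚ (+ m)) ⟩
  toℚᵘ (i / m) ℚᵘ.* toℚᵘ (ℤ→ℚ (+ m))    ≈⟨ ℚᵘP.*-cong (ℚP.toℚᵘ-fromℚᵘ (ℚᵘ.mkℚᵘ i m-1)) (toℚᵘ-ℤ→ℚ (+ m)) ⟩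
  ℚᵘ.mkℚᵘ i m-1 ℚᵘ.* ℚᵘ.mkℚᵘ (+ m) 0    ≈⟨ ℚᵘ.*≡* (≡.trans (ℤP.*-identityʳ (i ℤ.* + m)) (≡.cong (λ k → i ℤ.* + k) (≡.sym (ℕP.*-identityʳ m)))) ⟩
  ℚᵘ.mkℚᵘ i 0                           ≈⟨ toℚᵘ-ℤ→ℚ i ⟨
  toℚᵘ (ℤ→ℚ i)                          ∎)
  where open import Relation.Binary.Reasoning.Setoid ℚᵘP.≃-setoid

∣-of-* : ∀ {m} {i j : ℤ} → + m ℤ.* i ≡ j → m ℕ∣.∣ ℤ.∣ j ∣
∣-of-* {m} {i} m*i≡j = ℤ∣.∣⇒∣ᵤ (ℤ∣.divides i (≡.trans (≡.sym m*i≡j) (ℤP.*-comm (+ m) i)))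

↧ₙ[i/m]∣m : ∀ i m .{{_ : NonZero m}} → ↧ₙ (i / m) ℕ∣.∣ m
↧ₙ[i/m]∣m i m = ∣-of-* (ℚP.↧-/ i m)

-- The p-integral rationals modulo p, and residues.

module Localisation (p : ℕ) where

  open Coprime using (Coprime)

  -- Reduced denominators of sums and products merely divide the product of the denominators, hence
  -- this form. A common divisor of m and p is prime to k, so it divides l and must be 1.
  ∣-*-coprime : ∀ {k l m} → m ℕ∣.∣ k ℕ.* l → Coprime k p → Coprime l p → Coprime m p
  ∣-*-coprime m∣kl k⊥p l⊥p (d∣m , d∣p) = l⊥p
    (Coprime.coprime-divisor (λ (e∣d , e∣k) → k⊥p (e∣k , ℕ∣.∣-trans e∣d d∣p)) (ℕ∣.∣-trans d∣m m∣kl) , d∣p)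

  integral-+ : ∀ {a b} → a ∈ℤ₍ p ₎ → b ∈ℤ₍ p ₎ → a + b ∈ℤ₍ p ₎
  integral-+ {a} {b} (p-integral a⊥p) (p-integral b⊥p) = p-integral (∣-*-coprime {↧ₙ a} {↧ₙ b}
    (≡.subst (↧ₙ (a + b) ℕ∣.∣_) (ℤP.abs-* (↧ a) (↧ b)) (∣-of-* (ℚP.↧-+ a b))) a⊥p b⊥p)

  integral-* : ∀ {a b} → a ∈ℤ₍ p ₎ → b ∈ℤ₍ p ₎ → a * b ∈ℤ₍ p ₎
  integral-* {a} {b} (p-integral a⊥p) (p-integral b⊥p) = p-integral (∣-*-coprime {↧ₙ a} {↧ₙ b}
    (≡.subst (↧ₙ (a * b) ℕ∣.∣_) (ℤP.abs-* (↧ a) (↧ b)) (∣-of-* (ℚP.↧-* a b))) a⊥p b⊥p)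

  integral-neg : ∀ {a} → a ∈ℤ₍ p ₎ → - a ∈ℤ₍ p ₎
  integral-neg {a} (p-integral a⊥p) =
    p-integral (≡.subst (λ d → Coprime d p) (≡.sym (ℤP.+-injective (ℚP.↧-neg a))) a⊥p)

  integral-/ : ∀ i m .{{_ : NonZero m}} → Coprime m p → (i / m) ∈ℤ₍ p ₎
  integral-/ i m m⊥p = p-integral (λ (d∣ , d∣p) → m⊥p (ℕ∣.∣-trans d∣ (↧ₙ[i/m]∣m i m) , d∣p))

  integral-ℤ→ℚ : ∀ i → ℤ→ℚ i ∈ℤ₍ p ₎
  integral-ℤ→ℚ i = integral-/ i 1 (Coprime.1-coprimeTo p)

  private
    P : ℚ
    P = ℕ→ℚ p

  open ℚS using (solve; con; _:+_; _:*_; _:-_; :-_; _:=_)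

  mod-reflexive : ∀ {a b} → a ∈ℤ₍ p ₎ → a ≡ b → a ≡ b [mod p ]
  mod-reflexive {a} a∈ ≡.refl = congruent a∈ a∈ 0ℚ (integral-ℤ→ℚ (+ 0))
    (solve 2 (λ a P → a :- a := P :* con 0ℚ) ≡.refl a P)

  mod-sym : ∀ {a b} → a ≡ b [mod p ] → b ≡ a [mod p ]
  mod-sym {a} {b} (congruent a∈ b∈ q q∈ a-b≡pq) = congruent b∈ a∈ (- q) (integral-neg q∈)
    (≡.trans (solve 2 (λ a b → b :- a := :- (a :- b)) ≡.refl a b)
      (≡.trans (≡.cong -_ a-b≡pq) (solve 2 (λ P q → :- (P :* q) := P :* :- q) ≡.refl P q)))

  mod-trans : ∀ {a b c} → a ≡ b [mod p ] → b ≡ c [mod p ] → a ≡ c [mod p ]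
  mod-trans {a} {b} {c} (congruent a∈ _ q q∈ a-b≡pq) (congruent _ c∈ r r∈ b-c≡pr) =
    congruent a∈ c∈ (q + r) (integral-+ q∈ r∈)
      (≡.trans (solve 3 (λ a b c → a :- c := (a :- b) :+ (b :- c)) ≡.refl a b c)
        (≡.trans (≡.cong₂ _+_ a-b≡pq b-c≡pr) (solve 3 (λ P q r → P :* q :+ P :* r := P :* (q :+ r)) ≡.refl P q r)))

  mod-+ : ∀ {a b c d} → a ≡ b [mod p ] → c ≡ d [mod p ] → a + c ≡ b + d [mod p ]
  mod-+ {a} {b} {c} {d} (congruent a∈ b∈ q q∈ a-b≡pq) (congruent c∈ d∈ r r∈ c-d≡pr) =
    congruent (integral-+ a∈ c∈) (integral-+ b∈ d∈) (q + r) (integral-+ q∈ r∈)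
      (≡.trans (solve 4 (λ a b c d → (a :+ c) :- (b :+ d) := (a :- b) :+ (c :- d)) ≡.refl a b c d)
        (≡.trans (≡.cong₂ _+_ a-b≡pq c-d≡pr) (solve 3 (λ P q r → P :* q :+ P :* r := P :* (q :+ r)) ≡.refl P q r)))

  mod-* : ∀ {a b c d} → a ≡ b [mod p ] → c ≡ d [mod p ] → a * c ≡ b * d [mod p ]
  mod-* {a} {b} {c} {d} (congruent a∈ b∈ q q∈ a-b≡pq) (congruent c∈ d∈ r r∈ c-d≡pr) =
    congruent (integral-* a∈ c∈) (integral-* b∈ d∈) (q * c + b * r) (integral-+ (integral-* q∈ c∈) (integral-* b∈ r∈))
      (≡.trans (solve 4 (λ a b c d → a :* c :- b :* d := (a :- b) :* c :+ b :* (c :- d)) ≡.refl a b c d)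
        (≡.trans (≡.cong₂ (λ x y → x * c + b * y) a-b≡pq c-d≡pr)
          (solve 5 (λ P q r c b → P :* q :* c :+ b :* (P :* r) := P :* (q :* c :+ b :* r)) ≡.refl P q r c b)))

  mod-neg : ∀ {a b} → a ≡ b [mod p ] → - a ≡ - b [mod p ]
  mod-neg {a} {b} (congruent a∈ b∈ q q∈ a-b≡pq) =
    congruent (integral-neg a∈) (integral-neg b∈) (- q) (integral-neg q∈)
      (≡.trans (solve 2 (λ a b → :- a :- :- b := :- (a :- b)) ≡.refl a b)
        (≡.trans (≡.cong -_ a-b≡pq) (solve 2 (λ P q → :- (P :* q) := P :* :- q) ≡.refl P q)))

  p≡0 : ℕ→ℚ p ≡ 0ℚ [mod p ]
  p≡0 = congruent (integral-ℤ→ℚ (+ p)) (integral-ℤ→ℚ (+ 0)) 1ℚ (integral-ℤ→ℚ (+ 1))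
    (solve 1 (λ P → P :- con 0ℚ := P :* con 1ℚ) ≡.refl P)

  -- Opaque because evaluating numerals such as ι 32 in ℚ during conversion takes exponential time.
  opaque
    ℤₚ/p : CommutativeRing 0ℓ 0ℓ
    ℤₚ/p = record
      { Carrier = ∃ λ a → a ∈ℤ₍ p ₎
      ; _≈_ = λ x y → proj₁ x ≡ proj₁ y [mod p ]
      ; _+_ = λ x y → proj₁ x + proj₁ y , integral-+ (proj₂ x) (proj₂ y)
      ; _*_ = λ x y → proj₁ x * proj₁ y , integral-* (proj₂ x) (proj₂ y)
      ; -_ = λ x → - proj₁ x , integral-neg (proj₂ x)
      ; 0# = 0ℚ , integral-ℤ→ℚ (+ 0)
      ; 1# = 1ℚ , integral-ℤ→ℚ (+ 1)
      ; isCommutativeRing = record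
        { isRing = record
          { +-isAbelianGroup = record
            { isGroup = record
              { isMonoid = record
                { isSemigroup = record
                  { isMagma = record
                    { isEquivalence = record
                      { refl = λ {x} → mod-reflexive (proj₂ x) ≡.refl
                      ; sym = mod-sym
                      ; trans = mod-trans
                      }
                    ; ∙-cong = mod-+
                    }
                  ; assoc = λ (a , a∈) (b , b∈) (c , c∈) →
                      mod-reflexive (integral-+ (integral-+ a∈ b∈) c∈) (ℚP.+-assoc a b c)
                  }
                ; identity = (λ (a , a∈) → mod-sym (mod-reflexive a∈ (≡.sym (ℚP.+-identityˡ a))))
                           , (λ (a , a∈) → mod-sym (mod-reflexive a∈ (≡.sym (ℚP.+-identityʳ a))))
                }
              ; inverse = (λ (a , a∈) → mod-reflexive (integral-+ (integral-neg a∈) a∈) (ℚP.+-inverseˡ a))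
                        , (λ (a , a∈) → mod-reflexive (integral-+ a∈ (integral-neg a∈)) (ℚP.+-inverseʳ a))
              ; ⁻¹-cong = mod-neg
              }
            ; comm = λ (a , a∈) (b , b∈) → mod-reflexive (integral-+ a∈ b∈) (ℚP.+-comm a b)
            }
          ; *-cong = mod-*
          ; *-assoc = λ (a , a∈) (b , b∈) (c , c∈) →
              mod-reflexive (integral-* (integral-* a∈ b∈) c∈) (ℚP.*-assoc a b c)
          ; *-identity = (λ (a , a∈) → mod-sym (mod-reflexive a∈ (≡.sym (ℚP.*-identityˡ a))))
                       , (λ (a , a∈) → mod-sym (mod-reflexive a∈ (≡.sym (ℚP.*-identityʳ a))))
          ; distrib = (λ (a , a∈) (b , b∈) (c , c∈) →
                        mod-reflexive (integral-* a∈ (integral-+ b∈ c∈)) (ℚP.*-distribˡ-+ a b c))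
                    , (λ (a , a∈) (b , b∈) (c , c∈) →
                        mod-reflexive (integral-* (integral-+ b∈ c∈) a∈) (ℚP.*-distribʳ-+ a b c))
          }
        ; *-comm = λ (a , a∈) (b , b∈) → mod-reflexive (integral-* a∈ b∈) (ℚP.*-comm a b)
        }
      }

    toℚ : CommutativeRing.Carrier ℤₚ/p → ℚ
    toℚ = proj₁

    toℚ-integral : ∀ x → toℚ x ∈ℤ₍ p ₎
    toℚ-integral = proj₂

    fromℚ : ∀ a → a ∈ℤ₍ p ₎ → CommutativeRing.Carrier ℤₚ/p
    fromℚ = _,_

    toℚ-fromℚ : ∀ a a∈ → toℚ (fromℚ a a∈) ≡ a
    toℚ-fromℚ _ _ = ≡.refl

  module ℤₚ = CommutativeRing ℤₚ/p
  open ℤₚ using () renaming (_≈_ to _≈ₚ_; _+_ to _+ₚ_; _*_ to _*ₚ_; -_ to -ₚ_)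

  opaque
    unfolding ℤₚ/p toℚ

    toMod : ∀ {x y} → x ≈ₚ y → toℚ x ≡ toℚ y [mod p ]
    toMod x≈y = x≈y

    fromMod : ∀ {x y} → toℚ x ≡ toℚ y [mod p ] → x ≈ₚ y
    fromMod x≡y = x≡y

    toℚ-0 : toℚ ℤₚ.0# ≡ 0ℚ
    toℚ-0 = ≡.refl

    toℚ-1 : toℚ ℤₚ.1# ≡ 1ℚ
    toℚ-1 = ≡.refl

    toℚ-+ : ∀ x y → toℚ (x +ₚ y) ≡ toℚ x + toℚ y
    toℚ-+ _ _ = ≡.refl

    toℚ-* : ∀ x y → toℚ (x *ₚ y) ≡ toℚ x * toℚ y
    toℚ-* _ _ = ≡.refl

    toℚ-neg : ∀ x → toℚ (-ₚ x) ≡ - toℚ x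
    toℚ-neg _ = ≡.refl

  toℚ-− : ∀ x y → toℚ (x ℤₚ.- y) ≡ toℚ x - toℚ y
  toℚ-− x y = ≡.trans (toℚ-+ x (-ₚ y)) (≡.cong (λ z → toℚ x + z) (toℚ-neg y))

  open IntegerMultiples ℤₚ/p using (ι; ⟦_⟧)
  open FiniteSums ℤₚ/p using (∑<)
  open import Algebra.Properties.Semiring.Exp ℤₚ.semiring using () renaming (_^_ to _^ₚ_)

  toℚ-ι : ∀ m → toℚ (ι m) ≡ ℕ→ℚ m
  toℚ-ι zero          = toℚ-0
  toℚ-ι (suc zero)    = toℚ-1
  toℚ-ι (suc (suc m)) = begin
    toℚ (ι (suc m) +ₚ ℤₚ.1#)        ≡⟨ toℚ-+ (ι (suc m)) ℤₚ.1# ⟩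
    toℚ (ι (suc m)) + toℚ ℤₚ.1#     ≡⟨ ≡.cong₂ _+_ (toℚ-ι (suc m)) toℚ-1 ⟩
    ℕ→ℚ (suc m) + 1ℚ                ≡⟨ ℤ→ℚ-+ (+ suc m) (+ 1) ⟨
    ℕ→ℚ (suc m ℕ.+ 1)               ≡⟨ ≡.cong ℕ→ℚ (ℕP.+-comm (suc m) 1) ⟩
    ℕ→ℚ (suc (suc m))               ∎
    where open ≡.≡-Reasoning

  toℚ-⟦⟧ : ∀ i → toℚ ⟦ i ⟧ ≡ ℤ→ℚ i
  toℚ-⟦⟧ (+ m)    = toℚ-ι m
  toℚ-⟦⟧ -[1+ m ] = begin
    toℚ (-ₚ ι (suc m))      ≡⟨ toℚ-neg (ι (suc m)) ⟩
    - toℚ (ι (suc m))       ≡⟨ ≡.cong -_ (toℚ-ι (suc m)) ⟩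
    - ℕ→ℚ (suc m)           ≡⟨ ℤ→ℚ-neg (+ suc m) ⟨
    ℤ→ℚ -[1+ m ]            ∎
    where open ≡.≡-Reasoning

  toℚ-^ : ∀ x m → toℚ (x ^ₚ m) ≡ toℚ x ^ m
  toℚ-^ x zero    = toℚ-1
  toℚ-^ x (suc m) = ≡.trans (toℚ-* x (x ^ₚ m)) (≡.cong (toℚ x *_) (toℚ-^ x m))

  opaque
    unfolding ∑<

    toℚ-∑ : ∀ N f → toℚ (∑< N f) ≡ ∑[ i < N ] toℚ (f (toℕ i))
    toℚ-∑ zero    f = toℚ-0
    toℚ-∑ (suc N) f = ≡.trans (toℚ-+ (f 0) _) (≡.cong (λ z → toℚ (f 0) + z) (toℚ-∑ N (f ∘ suc)))

  toℚ-∑-cong : ∀ N f {g : ℕ → ℚ} → (∀ {i} → i < N → toℚ (f i) ≡ g i) → toℚ (∑< N f) ≡ ∑[ i < N ] g (toℕ i)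
  toℚ-∑-cong N f f≡g = ≡.trans (toℚ-∑ N f) (ℚΣ.sum-cong-≗ (λ i → f≡g (toℕ<n i)))

  ι-p≈0 : ι p ≈ₚ ℤₚ.0#
  ι-p≈0 = fromMod (≡.subst₂ (λ a b → a ≡ b [mod p ]) (≡.sym (toℚ-ι p)) (≡.sym toℚ-0) p≡0)

  -- Write x = n/d. Dividing r d - n = q p by d gives r - x = p (q/d), and q/d is p-integral because
  -- d is prime to p.
  IsResidue⇒≈ : ∀ x r → IsResidue p (toℚ x) r → x ≈ₚ ι (toℕ r)
  IsResidue⇒≈ x r (ℤ∣.divides q rd-n≡qp) = fromMod (mod-sym (congruent
    (toℚ-integral (ι (toℕ r))) (toℚ-integral x) (ℤ→ℚ q * e) (integral-* (integral-ℤ→ℚ q) (integral-/ (+ 1) (↧ₙ a) (_∈ℤ₍_₎.denominator-coprime (toℚ-integral x)))) (begin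
      toℚ (ι (toℕ r)) - a                                 ≡⟨ ≡.cong (_- a) (toℚ-ι (toℕ r)) ⟩
      ℕ→ℚ (toℕ r) - a                                       ≡⟨ solve 2 (λ r a → r :- a := (r :- a) :* con 1ℚ) ≡.refl (ℕ→ℚ (toℕ r)) a ⟩
      (ℕ→ℚ (toℕ r) - a) * 1ℚ                                ≡⟨ ≡.cong ((ℕ→ℚ (toℕ r) - a) *_) (/-*-cancel (+ 1) (↧ₙ a)) ⟨
      (ℕ→ℚ (toℕ r) - a) * (e * D)                           ≡⟨ solve 4 (λ r a e d → (r :- a) :* (e :* d) := (r :* d :- a :* d) :* e) ≡.refl (ℕ→ℚ (toℕ r)) a e D ⟩
      (ℕ→ℚ (toℕ r) * D - a * D) * e                         ≡⟨ ≡.cong (_* e) (≡.cong₂ _-_ (≡.sym (ℤ→ℚ-* (+ toℕ r) (↧ a))) a*D) ⟩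
      (ℤ→ℚ (+ toℕ r ℤ.* ↧ a) - ℤ→ℚ (↥ a)) * e               ≡⟨ ≡.cong (λ z → (ℤ→ℚ (+ toℕ r ℤ.* ↧ a) + z) * e) (ℤ→ℚ-neg (↥ a)) ⟨
      (ℤ→ℚ (+ toℕ r ℤ.* ↧ a) + ℤ→ℚ (ℤ.- ↥ a)) * e           ≡⟨ ≡.cong (_* e) (ℤ→ℚ-+ (+ toℕ r ℤ.* ↧ a) (ℤ.- ↥ a)) ⟨
      ℤ→ℚ (+ toℕ r ℤ.* ↧ a ℤ.- ↥ a) * e                     ≡⟨ ≡.cong (λ z → ℤ→ℚ z * e) rd-n≡qp ⟩
      ℤ→ℚ (q ℤ.* + p) * e                                   ≡⟨ ≡.cong (_* e) (ℤ→ℚ-* q (+ p)) ⟩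
      (ℤ→ℚ q * ℕ→ℚ p) * e                                   ≡⟨ solve 3 (λ q P e → (q :* P) :* e := P :* (q :* e)) ≡.refl (ℤ→ℚ q) (ℕ→ℚ p) e ⟩
      ℕ→ℚ p * (ℤ→ℚ q * e)                                   ∎)))
    where
    open ≡.≡-Reasoning
    a e D : ℚ
    a = toℚ x
    e = + 1 / ↧ₙ a
    D = ℤ→ℚ (↧ a)
    a*D : a * D ≡ ℤ→ℚ (↥ a)
    a*D = ≡.trans (≡.cong (_* D) (≡.sym (ℚP.↥p/↧p≡p a))) (/-*-cancel (↥ a) (↧ₙ a))

  ∃-inverse : ∀ {d} → Coprime d p → ∃ λ u → + p ℤ∣.∣ u ℤ.* + d ℤ.- + 1
  ∃-inverse {d} d⊥p with Coprime.coprime-Bézout d⊥p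
  ... | Bézout.+- x y eq = + x , ℤ∣.divides (+ y) (begin
    + x ℤ.* + d ℤ.- + 1                 ≡⟨ ≡.cong (ℤ._- + 1) (ℤP.pos-* x d) ⟨
    + (x ℕ.* d) ℤ.- + 1                 ≡⟨ ≡.cong (λ z → + z ℤ.- + 1) eq ⟨
    + (1 ℕ.+ y ℕ.* p) ℤ.- + 1           ≡⟨⟩
    + (y ℕ.* p)                         ≡⟨ ℤP.pos-* y p ⟩
    + y ℤ.* + p                         ∎)
    where open ≡.≡-Reasoning
  ... | Bézout.-+ x y eq = ℤ.- + x , ℤ∣.divides (ℤ.- + y) (begin
    ℤ.- + x ℤ.* + d ℤ.- + 1             ≡⟨ ℤS.solve 2 (λ x d → (ℤS.:- x ℤS.:* d) ℤS.:- ℤS.con (+ 1) ℤS.:= ℤS.:- (ℤS.con (+ 1) ℤS.:+ x ℤS.:* d)) ≡.refl (+ x) (+ d) ⟩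
    ℤ.- (+ 1 ℤ.+ + x ℤ.* + d)           ≡⟨ ≡.cong (λ z → ℤ.- (+ 1 ℤ.+ z)) (ℤP.pos-* x d) ⟨
    ℤ.- + (1 ℕ.+ x ℕ.* d)               ≡⟨ ≡.cong (λ z → ℤ.- + z) eq ⟩
    ℤ.- + (y ℕ.* p)                     ≡⟨ ≡.cong ℤ.-_ (ℤP.pos-* y p) ⟩
    ℤ.- (+ y ℤ.* + p)                   ≡⟨ ℤP.neg-distribˡ-* (+ y) (+ p) ⟩
    ℤ.- + y ℤ.* + p                     ∎)
    where
    open ≡.≡-Reasoning

  -- For a = n/d and u inverse to d modulo p, the residue r is the remainder of n u. With s the
  -- quotient, r d - n = n (u d - 1) - s d p.
  ∃-residue : .{{_ : NonZero p}} → ∀ {a} → a ∈ℤ₍ p ₎ → ∃ λ r → IsResidue p a r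
  ∃-residue {a} (p-integral ↧a⊥p) with u , ℤ∣.divides q ud-1≡qp ← ∃-inverse ↧a⊥p =
    fromℕ< r<p , ℤ∣.divides (↥ a ℤ.* q ℤ.- s ℤ.* ↧ a) (begin
      + toℕ (fromℕ< r<p) ℤ.* ↧ a ℤ.- ↥ a                        ≡⟨ ≡.cong (λ r → + r ℤ.* ↧ a ℤ.- ↥ a) (toℕ-fromℕ< r<p) ⟩
      + r ℤ.* ↧ a ℤ.- ↥ a
        ≡⟨ ℤS.solve 5 (λ r d n s P → r ℤS.:* d ℤS.:- n ℤS.:= (r ℤS.:+ s ℤS.:* P) ℤS.:* d ℤS.:- n ℤS.:- s ℤS.:* d ℤS.:* P) ≡.refl (+ r) (↧ a) (↥ a) s (+ p) ⟩
      (+ r ℤ.+ s ℤ.* + p) ℤ.* ↧ a ℤ.- ↥ a ℤ.- s ℤ.* ↧ a ℤ.* + p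
        ≡⟨ ≡.cong (λ z → z ℤ.* ↧ a ℤ.- ↥ a ℤ.- s ℤ.* ↧ a ℤ.* + p) (ℤDM.a≡a%ℕn+[a/ℕn]*n (↥ a ℤ.* u) p) ⟨
      ↥ a ℤ.* u ℤ.* ↧ a ℤ.- ↥ a ℤ.- s ℤ.* ↧ a ℤ.* + p
        ≡⟨ ℤS.solve 4 (λ n u d z → n ℤS.:* u ℤS.:* d ℤS.:- n ℤS.:- z ℤS.:= n ℤS.:* (u ℤS.:* d ℤS.:- ℤS.con (+ 1)) ℤS.:- z) ≡.refl (↥ a) u (↧ a) (s ℤ.* ↧ a ℤ.* + p) ⟩
      ↥ a ℤ.* (u ℤ.* ↧ a ℤ.- + 1) ℤ.- s ℤ.* ↧ a ℤ.* + p
        ≡⟨ ≡.cong (λ z → ↥ a ℤ.* z ℤ.- s ℤ.* ↧ a ℤ.* + p) ud-1≡qp ⟩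
      ↥ a ℤ.* (q ℤ.* + p) ℤ.- s ℤ.* ↧ a ℤ.* + p
        ≡⟨ ℤS.solve 5 (λ n q P s d → n ℤS.:* (q ℤS.:* P) ℤS.:- s ℤS.:* d ℤS.:* P ℤS.:= (n ℤS.:* q ℤS.:- s ℤS.:* d) ℤS.:* P) ≡.refl (↥ a) q (+ p) s (↧ a) ⟩
      (↥ a ℤ.* q ℤ.- s ℤ.* ↧ a) ℤ.* + p                        ∎)
    where
    open ≡.≡-Reasoning
    r = (↥ a ℤ.* u) ℤDM.%ℕ p
    s = (↥ a ℤ.* u) ℤDM./ℕ p
    r<p : r < p
    r<p = ℤDM.n%ℕd<d (↥ a ℤ.* u) p

  represent : .{{_ : NonZero p}} → ∀ x → ∃ λ r → x ≈ₚ ι r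
  represent x = toℕ (proj₁ r) , IsResidue⇒≈ x (proj₁ r) (proj₂ r)
    where r = ∃-residue (toℚ-integral x)

  -- Existence of a residue rules out the branch in which `residue` falls back on its default value
  -- 0.
  residue-isResidue : ∀ a → (∃ λ r → IsResidue p a r) → ∃ λ r → residue p a ≡ + toℕ r × IsResidue p a r
  residue-isResidue a exists with any? {P = IsResidue p a} (λ r → + p ℤ∣.∣? + toℕ r ℤ.* ↧ a ℤ.- ↥ a)
  ... | yes (r , isResidue) = r , ≡.refl , isResidue
  ... | no  none            = contradiction exists none

  residue-≈ : .{{_ : NonZero p}} → ∀ x → ⟦ residue p (toℚ x) ⟧ ≈ₚ x
  residue-≈ x = from (residue-isResidue (toℚ x) (∃-residue (toℚ-integral x)))
    where
    from : (∃ λ r → residue p (toℚ x) ≡ + toℕ r × IsResidue p (toℚ x) r) → ⟦ residue p (toℚ x) ⟧ ≈ₚ x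
    from (r , eq , isResidue) = ≡.subst (λ i → ⟦ i ⟧ ≈ₚ x) (≡.sym eq) (ℤₚ.sym (IsResidue⇒≈ x r isResidue))

-- Factor (2n-2k)! through C(2n-2k,n), whose complementary index is n - 2k since k ≤ n/2, and then
-- n! through C(n,k). The coefficients are thus integers, and 2ⁿ is the only denominator left in Pₙ.
legendreCoeff-≡ : ∀ {n k} → k ≤ n ℕ./ 2 →
  legendreCoeff n k ≡ ℤ→ℚ (-1ℤ ℤ.^ k ℤ.* + ((n C k) ℕ.* ((2 ℕ.* n ∸ 2 ℕ.* k) C n)))
legendreCoeff-≡ {n} {k} k≤n/2 = ≡.trans (ℚP./-cong numerator ≡.refl) ([q*m]/m (-1ℤ ℤ.^ k ℤ.* + s) m)
  where
  open ≡.≡-Reasoning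
  N m s : ℕ
  N = 2 ℕ.* n ∸ 2 ℕ.* k
  m = k ! ℕ.* (n ∸ k) ! ℕ.* (n ∸ 2 ℕ.* k) !
  s = (n C k) ℕ.* (N C n)
  instance
    m≢0 : NonZero m
    m≢0 = ℕP.m*n≢0 (k ! ℕ.* (n ∸ k) !) ((n ∸ 2 ℕ.* k) !) {{ℕP._!*_!≢0 k (n ∸ k)}} {{ℕP._!≢0 (n ∸ 2 ℕ.* k)}}
  C-! : ∀ {a b} → b ≤ a → (a C b) ℕ.* (b ! ℕ.* (a ∸ b) !) ≡ a !
  C-! {a} {b} b≤a = ≡.trans (≡.cong (ℕ._* (b ! ℕ.* (a ∸ b) !)) (nCk≡n!/k![n-k]! b≤a))
    (ℕDM.m/n*n≡m {{ℕP._!*_!≢0 b (a ∸ b)}} (k![n∸k]!∣n! b≤a))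
  2k≤n : 2 ℕ.* k ≤ n
  2k≤n = ≡.subst (_≤ n) (ℕP.*-comm k 2) (ℕP.≤-trans (ℕP.*-monoˡ-≤ 2 k≤n/2) (ℕDM.m/n*n≤m n 2))
  N≡ : N ≡ n ℕ.+ (n ∸ 2 ℕ.* k)
  N≡ = ≡.trans (≡.cong (_∸ 2 ℕ.* k) (≡.cong (n ℕ.+_) (ℕP.+-identityʳ n))) (ℕP.+-∸-assoc n 2k≤n)
  N! : N ! ≡ s ℕ.* m
  N! = begin
    N !
      ≡⟨ C-! (≡.subst (n ≤_) (≡.sym N≡) (ℕP.m≤m+n n _)) ⟨
    (N C n) ℕ.* (n ! ℕ.* (N ∸ n) !)
      ≡⟨ ≡.cong (λ j → (N C n) ℕ.* (n ! ℕ.* j !)) (≡.trans (≡.cong (_∸ n) N≡) (ℕP.m+n∸m≡n n _)) ⟩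
    (N C n) ℕ.* (n ! ℕ.* (n ∸ 2 ℕ.* k) !)
      ≡⟨ ≡.cong (λ j → (N C n) ℕ.* (j ℕ.* (n ∸ 2 ℕ.* k) !)) (C-! (ℕP.≤-trans k≤n/2 (ℕDM.m/n≤m n 2))) ⟨
    (N C n) ℕ.* ((n C k) ℕ.* (k ! ℕ.* (n ∸ k) !) ℕ.* (n ∸ 2 ℕ.* k) !)
      ≡⟨ ℕS.solve 4 (λ a b c d → a ℕS.:* (b ℕS.:* c ℕS.:* d) ℕS.:= (b ℕS.:* a) ℕS.:* (c ℕS.:* d)) ≡.refl (N C n) (n C k) (k ! ℕ.* (n ∸ k) !) ((n ∸ 2 ℕ.* k) !) ⟩
    s ℕ.* m ∎
  numerator : -1ℤ ℤ.^ k ℤ.* + (N !) ≡ (-1ℤ ℤ.^ k ℤ.* + s) ℤ.* + m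
  numerator = begin
    -1ℤ ℤ.^ k ℤ.* + (N !)               ≡⟨ ≡.cong (λ j → -1ℤ ℤ.^ k ℤ.* + j) N! ⟩
    -1ℤ ℤ.^ k ℤ.* + (s ℕ.* m)           ≡⟨ ≡.cong (-1ℤ ℤ.^ k ℤ.*_) (ℤP.pos-* s m) ⟩
    -1ℤ ℤ.^ k ℤ.* (+ s ℤ.* + m)         ≡⟨ ℤP.*-assoc (-1ℤ ℤ.^ k) (+ s) (+ m) ⟨
    (-1ℤ ℤ.^ k ℤ.* + s) ℤ.* + m         ∎

-- χ stands for the Legendre symbol; were it not abstract, comparing types would unfold legendre.
Congruences : (ℚ → ℤ) → ℕ → ℕ → ℚ → Set
Congruences χ p n t =
    let
      binomialSum = ∑[ k ≤ n ] (ℕ→ℚ (((2 ℕ.* toℕ k) C toℕ k) ℕ.^ 2) * ((1ℚ - t) * (+ 1 / 32)) ^ toℕ k)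
      cubic = λ (x : ℚ) → x ^ 3 - ℕ→ℚ 3 * (t ^ 2 + ℕ→ℚ 3) * x + ℕ→ℚ 2 * t * (t ^ 2 - ℕ→ℚ 9)
      characterSum = ∑[ x < p ] ℤ→ℚ (χ (cubic (ℕ→ℚ (toℕ x))))
    in
      (legendreP n t ≡ binomialSum [mod p ])
      × (binomialSum ≡ - (ℤ→ℚ (χ (ℤ→ℚ (-[1+ 5 ]))) * characterSum) [mod p ])

-- Transfer of the congruences to ℚ.

module _ (n : ℕ) (p-prime : Prime (suc (n ℕ.* 2))) (3<p : 3 < suc (n ℕ.* 2)) where

  private
    p : ℕ
    p = suc (n ℕ.* 2)

    0<n : 0 < n
    0<n = positive n 3<p
      where
      positive : ∀ n → 3 < suc (n ℕ.* 2) → 0 < n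
      positive zero    (s≤s ())
      positive (suc n) _ = z<s

  open Localisation p
  open ℤₚ using (_≈_; 1#; *-congˡ; *-congʳ; *-cong; -‿cong)
    renaming (Carrier to Z; _+_ to _⊕_; _*_ to _⊛_; _-_ to _⊖_; -_ to ⊝_)
  open IntegerMultiples ℤₚ/p using (ι; ⟦_⟧; ⟦⟧-*; ι-*)
  open FiniteSums ℤₚ/p using (∑<; ∑-cong)
  open PrimeCharacteristic ℤₚ/p n p-prime 0<n ι-p≈0 represent
    using (legendreℤ-≈; cubicSum; ∑ₚ-∑; binomialSum-≈; legendreSum-≈) renaming (cubic to cubicₚ)
  open import Algebra.Properties.Semiring.Exp ℤₚ.semiring using (^-congˡ) renaming (_^_ to _^ₚ_)

  legendre-≈ : ∀ x → ⟦ legendre (toℚ x) (suc (n ℕ.* 2)) ⟧ ≈ x ^ₚ n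
  legendre-≈ x = ℤₚ.trans (legendreℤ-≈ (residue p (toℚ x))) (^-congˡ n (residue-≈ x))

  reciprocal : ∀ m .{{_ : NonZero m}} → Coprime.Coprime m p → Z
  reciprocal m m⊥p = fromℚ (+ 1 / m) (integral-/ (+ 1) m m⊥p)

  toℚ-reciprocal : ∀ m .{{_ : NonZero m}} (m⊥p : Coprime.Coprime m p) → toℚ (reciprocal m m⊥p) ≡ + 1 / m
  toℚ-reciprocal m m⊥p = toℚ-fromℚ (+ 1 / m) (integral-/ (+ 1) m m⊥p)

  ι-*-reciprocal : ∀ m .{{_ : NonZero m}} (m⊥p : Coprime.Coprime m p) → ι m ⊛ reciprocal m m⊥p ≈ 1#
  ι-*-reciprocal m m⊥p = fromMod (mod-reflexive (toℚ-integral _) (begin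
    toℚ (ι m ⊛ reciprocal m m⊥p)           ≡⟨ toℚ-* (ι m) (reciprocal m m⊥p) ⟩
    toℚ (ι m) * toℚ (reciprocal m m⊥p)     ≡⟨ ≡.cong₂ _*_ (toℚ-ι m) (toℚ-reciprocal m m⊥p) ⟩
    ℕ→ℚ m * (+ 1 / m)                      ≡⟨ ℚP.*-comm (ℕ→ℚ m) (+ 1 / m) ⟩
    (+ 1 / m) * ℕ→ℚ m                      ≡⟨ /-*-cancel (+ 1) m ⟩
    ℕ→ℚ 1                                  ≡⟨ toℚ-ι 1 ⟨
    toℚ 1#                                 ∎))
    where open ≡.≡-Reasoning

  -- Covers both denominators that are inverted: 32 = 2⁵ in the binomial sum and 2ⁿ in the Legendre
  -- polynomial.
  2^-coprime : ∀ m → Coprime.Coprime (2 ℕ.^ m) p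
  2^-coprime zero    = Coprime.1-coprimeTo p
  2^-coprime (suc m) = ∣-*-coprime {2} {2 ℕ.^ m} ℕ∣.∣-refl
    (Coprime.sym (Coprime.prime⇒coprime p-prime (ℕP.<-trans (s<s (s<s z<s)) 3<p))) (2^-coprime m)

  ι-^ : ∀ a m → ι (a ℕ.^ m) ≈ ι a ^ₚ m
  ι-^ a zero    = ℤₚ.refl
  ι-^ a (suc m) = ℤₚ.trans (ι-* a (a ℕ.^ m)) (*-congˡ (ι-^ a m))

  ⟦-1^_⟧ : ∀ k → ⟦ -1ℤ ℤ.^ k ⟧ ≈ (⊝ 1#) ^ₚ k
  ⟦-1^ zero ⟧  = ℤₚ.refl
  ⟦-1^ suc k ⟧ = ℤₚ.trans (⟦⟧-* -1ℤ (-1ℤ ℤ.^ k)) (*-congˡ ⟦-1^ k ⟧)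

  -- All three expressions are compared with `target`. The index m is separate from n because (p ∸
  -- 1)/2 equals n only propositionally.
  congruences : ∀ (χ : ℚ → ℤ) → (∀ x → ⟦ χ (toℚ x) ⟧ ≈ x ^ₚ n) → ∀ t → t ∈ℤ₍ p ₎ →
    ∀ {m} → m ≡ n → Congruences χ (suc (n ℕ.* 2)) m t
  congruences χ χ-≈ t t∈ ≡.refl =
      ≡.subst₂ (λ a b → a ≡ b [mod p ]) toℚ-legendreSum toℚ-binomialSum
        (toMod (ℤₚ.trans legendreSum≈ (ℤₚ.sym binomialSum≈)))
    , ≡.subst₂ (λ a b → a ≡ b [mod p ]) toℚ-binomialSum toℚ-characterSum
        (toMod (ℤₚ.trans binomialSum≈ (ℤₚ.sym characterSum≈)))
    where
    instance
      2^n≢0 : NonZero (2 ℕ.^ n)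
      2^n≢0 = ℕP.m^n≢0 2 n
    τ e g target : Z
    τ = fromℚ t t∈
    e = reciprocal 32 (2^-coprime 5)
    g = reciprocal (2 ℕ.^ n) (2^-coprime n)
    target = ⊝ ((⊝ ι 6) ^ₚ n ⊛ cubicSum τ)

    toℚ-τ : toℚ τ ≡ t
    toℚ-τ = toℚ-fromℚ t t∈

    coeff : ℕ → ℤ
    coeff k = -1ℤ ℤ.^ k ℤ.* + ((n C k) ℕ.* ((2 ℕ.* n ∸ 2 ℕ.* k) C n))

    binomialSum legendreSum characterSum : Z
    binomialSum = ∑< (suc n) (λ k → ι (((2 ℕ.* k) C k) ℕ.^ 2) ⊛ ((1# ⊖ τ) ⊛ e) ^ₚ k)
    legendreSum = g ⊛ ∑< (suc (n ℕ./ 2)) (λ k → ⟦ coeff k ⟧ ⊛ τ ^ₚ (n ∸ 2 ℕ.* k))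
    characterSum = ⊝ (⟦ χ (toℚ ⟦ -[1+ 5 ] ⟧) ⟧ ⊛ ∑< p (λ x → ⟦ χ (toℚ (cubicₚ τ (ι x))) ⟧))

    binomialSum≈ : binomialSum ≈ target
    binomialSum≈ = binomialSum-≈ 3<p τ e (ι-*-reciprocal 32 (2^-coprime 5))

    legendreSum≈ : legendreSum ≈ target
    legendreSum≈ = ℤₚ.trans
      (*-congˡ (∑-cong (suc (n ℕ./ 2)) (λ {k} _ → *-congʳ (ℤₚ.trans
        (⟦⟧-* (-1ℤ ℤ.^ k) (+ ((n C k) ℕ.* ((2 ℕ.* n ∸ 2 ℕ.* k) C n)))) (*-congʳ ⟦-1^ k ⟧)))))
      (legendreSum-≈ 3<p τ g (ℤₚ.trans (*-congʳ (ℤₚ.sym (ι-^ 2 n))) (ι-*-reciprocal (2 ℕ.^ n) (2^-coprime n))))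

    characterSum≈ : characterSum ≈ target
    characterSum≈ = -‿cong (*-cong (χ-≈ ⟦ -[1+ 5 ] ⟧)
      (ℤₚ.trans (∑-cong p (λ {x} _ → χ-≈ (cubicₚ τ (ι x)))) (ℤₚ.sym (∑ₚ-∑ _))))

    open ≡.≡-Reasoning

    toℚ-binomialSum : toℚ binomialSum
                    ≡ ∑[ k ≤ n ] (ℕ→ℚ (((2 ℕ.* toℕ k) C toℕ k) ℕ.^ 2) * ((1ℚ - t) * (+ 1 / 32)) ^ toℕ k)
    toℚ-binomialSum = toℚ-∑-cong (suc n) _ (λ {k} _ → begin
      toℚ (ι (((2 ℕ.* k) C k) ℕ.^ 2) ⊛ ((1# ⊖ τ) ⊛ e) ^ₚ k)
        ≡⟨ toℚ-* _ _ ⟩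
      toℚ (ι (((2 ℕ.* k) C k) ℕ.^ 2)) * toℚ (((1# ⊖ τ) ⊛ e) ^ₚ k)
        ≡⟨ ≡.cong₂ _*_ (toℚ-ι (((2 ℕ.* k) C k) ℕ.^ 2)) (≡.trans (toℚ-^ _ k) (≡.cong (_^ k) (begin
          toℚ ((1# ⊖ τ) ⊛ e)             ≡⟨ toℚ-* _ _ ⟩
          toℚ (1# ⊖ τ) * toℚ e           ≡⟨ ≡.cong₂ _*_ (toℚ-− 1# τ) (toℚ-reciprocal 32 (2^-coprime 5)) ⟩
          (toℚ 1# - toℚ τ) * (+ 1 / 32)  ≡⟨ ≡.cong₂ (λ a b → (a - b) * (+ 1 / 32)) toℚ-1 toℚ-τ ⟩
          (1ℚ - t) * (+ 1 / 32)          ∎))) ⟩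
      ℕ→ℚ (((2 ℕ.* k) C k) ℕ.^ 2) * ((1ℚ - t) * (+ 1 / 32)) ^ k ∎)

    toℚ-legendreSum : toℚ legendreSum ≡ legendreP n t
    toℚ-legendreSum = ≡.trans (toℚ-* _ _) (≡.cong₂ _*_ (toℚ-reciprocal (2 ℕ.^ n) (2^-coprime n))
      (toℚ-∑-cong (suc (n ℕ./ 2)) _ (λ {k} k<1+n/2 → begin
        toℚ (⟦ coeff k ⟧ ⊛ τ ^ₚ (n ∸ 2 ℕ.* k))             ≡⟨ toℚ-* _ _ ⟩
        toℚ ⟦ coeff k ⟧ * toℚ (τ ^ₚ (n ∸ 2 ℕ.* k))         ≡⟨ ≡.cong₂ _*_ (≡.trans (toℚ-⟦⟧ (coeff k)) (≡.sym (legendreCoeff-≡ (ℕ.s≤s⁻¹ k<1+n/2))))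
                                                               (≡.trans (toℚ-^ τ (n ∸ 2 ℕ.* k)) (≡.cong (_^ (n ∸ 2 ℕ.* k)) toℚ-τ)) ⟩
        legendreCoeff n k * t ^ (n ∸ 2 ℕ.* k)              ∎)))

    cubic : ℚ → ℚ
    cubic x = x ^ 3 - ℕ→ℚ 3 * (t ^ 2 + ℕ→ℚ 3) * x + ℕ→ℚ 2 * t * (t ^ 2 - ℕ→ℚ 9)

    toℚ-cubic : ∀ x → toℚ (cubicₚ τ (ι x)) ≡ cubic (ℕ→ℚ x)
    toℚ-cubic x = begin
      toℚ (ι x ^ₚ 3 ⊖ ι 3 ⊛ (τ ^ₚ 2 ⊕ ι 3) ⊛ ι x ⊕ ι 2 ⊛ τ ⊛ (τ ^ₚ 2 ⊖ ι 9))
        ≡⟨ toℚ-+ _ _ ⟩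
      toℚ (ι x ^ₚ 3 ⊖ ι 3 ⊛ (τ ^ₚ 2 ⊕ ι 3) ⊛ ι x) + toℚ (ι 2 ⊛ τ ⊛ (τ ^ₚ 2 ⊖ ι 9))
        ≡⟨ ≡.cong₂ _+_ (≡.trans (toℚ-− _ _) (≡.cong₂ _-_ (≡.trans (toℚ-^ (ι x) 3) (≡.cong (_^ 3) (toℚ-ι x))) left)) right ⟩
      cubic (ℕ→ℚ x) ∎
      where
      toℚ-τ² : toℚ (τ ^ₚ 2) ≡ t ^ 2
      toℚ-τ² = ≡.trans (toℚ-^ τ 2) (≡.cong (_^ 2) toℚ-τ)
      left : toℚ (ι 3 ⊛ (τ ^ₚ 2 ⊕ ι 3) ⊛ ι x) ≡ ℕ→ℚ 3 * (t ^ 2 + ℕ→ℚ 3) * ℕ→ℚ x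
      left = ≡.trans (toℚ-* _ _) (≡.cong₂ _*_
        (≡.trans (toℚ-* _ _) (≡.cong₂ _*_ (toℚ-ι 3) (≡.trans (toℚ-+ _ _) (≡.cong₂ _+_ toℚ-τ² (toℚ-ι 3))))) (toℚ-ι x))
      right : toℚ (ι 2 ⊛ τ ⊛ (τ ^ₚ 2 ⊖ ι 9)) ≡ ℕ→ℚ 2 * t * (t ^ 2 - ℕ→ℚ 9)
      right = ≡.trans (toℚ-* _ _) (≡.cong₂ _*_
        (≡.trans (toℚ-* _ _) (≡.cong₂ _*_ (toℚ-ι 2) toℚ-τ)) (≡.trans (toℚ-− _ _) (≡.cong₂ _-_ toℚ-τ² (toℚ-ι 9))))

    toℚ-χ : ∀ {a b} → a ≡ b → toℚ ⟦ χ a ⟧ ≡ ℤ→ℚ (χ b)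
    toℚ-χ {a} ≡.refl = toℚ-⟦⟧ (χ a)

    toℚ-characterSum : toℚ characterSum
                     ≡ - (ℤ→ℚ (χ (ℤ→ℚ (-[1+ 5 ]))) * ∑[ x < p ] ℤ→ℚ (χ (cubic (ℕ→ℚ (toℕ x)))))
    toℚ-characterSum = ≡.trans (toℚ-neg _) (≡.cong -_ (≡.trans (toℚ-* _ _) (≡.cong₂ _*_
      (toℚ-χ (toℚ-⟦⟧ -[1+ 5 ])) (toℚ-∑-cong p _ (λ {x} _ → toℚ-χ (toℚ-cubic x))))))

-- Remainder 0 would make 2 a divisor of the prime p, hence equal to p, against p > 3.
odd-prime : ∀ {p} → Prime p → p ℕ.> 3 → p ≡ suc (p ℕ./ 2 ℕ.* 2)
odd-prime {p} p-prime 3<p = by-parity (p ℕ.% 2) (ℕDM.m%n<n p 2) (ℕDM.m≡m%n+[m/n]*n p 2)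
  where
  by-parity : ∀ r → r < 2 → p ≡ r ℕ.+ p ℕ./ 2 ℕ.* 2 → p ≡ suc (p ℕ./ 2 ℕ.* 2)
  by-parity 1 _ p≡ = p≡
  by-parity (suc (suc _)) (s≤s (s≤s ())) _
  by-parity 0 _ p≡ with prime⇒irreducible p-prime (divides (p ℕ./ 2) p≡)
  ... | inj₂ 2≡p = contradiction (≡.subst (3 <_) (≡.sym 2≡p) 3<p) λ where (s≤s (s≤s ()))

theorem2p11 : ∀ (p : ℕ) → Prime p → p ℕ.> 3 → (t : ℚ) → t ∈ℤ₍ p ₎ →
    let
      n = (p ∸ 1) ℕ./ 2
      binomialSum = ∑[ k ≤ n ] (ℕ→ℚ (((2 ℕ.* toℕ k) C toℕ k) ℕ.^ 2) * ((1ℚ - t) * (+ 1 / 32)) ^ toℕ k)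
      cubic = λ (x : ℚ) → x ^ 3 - ℕ→ℚ 3 * (t ^ 2 + ℕ→ℚ 3) * x + ℕ→ℚ 2 * t * (t ^ 2 - ℕ→ℚ 9)
      characterSum = ∑[ x < p ] ℤ→ℚ (legendre (cubic (ℕ→ℚ (toℕ x))) p)
    in
      (legendreP n t ≡ binomialSum [mod p ])
      × (binomialSum ≡ - (ℤ→ℚ (legendre (ℤ→ℚ (-[1+ 5 ])) p) * characterSum) [mod p ])
theorem2p11 p p-prime 3<p t t∈ = go (p ℕ./ 2) (odd-prime p-prime 3<p) p-prime 3<p t∈
  where
  -- In the equation from `odd-prime` p occurs on both sides, so it cannot be matched directly.
  -- Generalising p to q and p/2 to n lets the match replace q by 2n + 1.
  go : ∀ n {q} → q ≡ suc (n ℕ.* 2) → Prime q → q ℕ.> 3 → t ∈ℤ₍ q ₎ →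
       Congruences (λ a → legendre a q) q ((q ∸ 1) ℕ./ 2) t
  go n ≡.refl q-prime 3<q t∈ = congruences n q-prime 3<q (λ a → legendre a (suc (n ℕ.* 2))) (legendre-≈ n q-prime 3<q) t t∈
    (ℕDM.m*n/n≡m n 2)
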